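{- Let $q$ be an odd prime power and let $\gamma\in\mathbb{F}_{q^2}$. If $\mathrm{char}(\mathbb{F}_{q^2})\neq3$, the polynomial $f(x)=x+\gamma\,\mathrm{Tr}\left(x^4+x^{q+3}\right)$ over $\mathbb{F}_{q^2}$ is a permutation polynomial if and only if $\gamma=0$. If $\mathrm{char}(\mathbb{F}_{q^2})=3$, the polynomial $f(x)=x+\gamma\,\mathrm{Tr}\left(x^4+x^{q+3}\right)$ over $\mathbb{F}_{q^2}$ is a permutation polynomial if and only if $\alpha\gamma\in\mathbb{F}_q$, where $\alpha\in\mathbb{F}_{q^2}$ satisfies $\alpha^2=u$ and $u\in\mathbb{F}_q$ is a quadratic non-residue in $\mathbb{F}_q$.
   Context: $\mathrm{Tr}:\mathbb{F}_{q^2}\to\mathbb{F}_q$ is the trace map $\mathrm{Tr}(x)=x+x^q$. A polynomial $f$ over $\mathbb{F}_{q^2}$ is a permutation polynomial if the map $x\mapsto f(x)$ is a bijection of $\mathbb{F}_{q^2}$ onto itself. $\mathrm{char}(\mathbb{F}_{q^2})$ is the characteristic of $\mathbb{F}_{q^2}$. The elements $u$ and $\alpha$ are arbitrary but fixed with the stated properties. -}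

module Defs where

open import Algebra.Apartness using (HeytingField; HeytingCommutativeRing)
open import Algebra.Bundles using (CommutativeRing; Semiring)
import Algebra.Definitions.RawSemiring as RawSemiringDefinitions
open import Algebra.Morphism.Structures using (IsRingMonomorphism)
import Data.Fin.Properties as Fin
open import Data.Nat.Base as ℕ using (ℕ)
open import Data.Nat.Divisibility using (_∣_)
open import Data.Nat.Primality using (Prime)
open import Data.Product.Base using (∃-syntax; _×_)
open import Function.Bundles using (Inverse; _⇔_)
import Function.Definitions as FunctionDefinitions
open import Level using (Level; _⊔_)
open import Relation.Binary.PropositionalEquality using (_≡_)
open import Relation.Nullary.Negation using (¬_)

private
  variable
    c ℓ₁ ℓ₂ c′ ℓ₁′ ℓ₂′ : Level

IsPrimePower : ℕ → Set
IsPrimePower q = ∃[ p ] ∃[ k ] (Prime p × 0 ℕ.< k × q ≡ p ℕ.^ k)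

-- `HeytingField` is the library's notion of field.  All fields below are also
-- assumed to be in bijection with some `Fin n`; then `_≈_` is decidable, and
-- `x # y` is equivalent to `¬ (x ≈ y)`, so these are exactly the usual finite
-- fields.
module FieldNotions (F : HeytingField c ℓ₁ ℓ₂) where

  commutativeRing : CommutativeRing c ℓ₁
  commutativeRing =
    HeytingCommutativeRing.commutativeRing (HeytingField.heytingCommutativeRing F)

  open CommutativeRing commutativeRing public
    using (Carrier; _≈_; _+_; _*_; 0#; 1#; setoid; semiring; rawRing)
  open RawSemiringDefinitions (Semiring.rawSemiring semiring) public
    using (_^_) renaming (_×_ to _·_)

  HasOrder : ℕ → Set (c ⊔ ℓ₁)
  HasOrder n = Inverse setoid (Fin.≡-setoid n)

  -- n generates the kernel of the canonical map m ↦ m · 1#.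
  HasCharacteristic : ℕ → Set ℓ₁
  HasCharacteristic n = ∀ m → (m · 1# ≈ 0#) ⇔ (n ∣ m)

  -- The zero element is a square, so a non-residue is automatically nonzero.
  IsQuadraticNonResidue : Carrier → Set (c ⊔ ℓ₁)
  IsQuadraticNonResidue u = ¬ (∃[ v ] v ^ 2 ≈ u)

  -- The property of a polynomial depends only on the map it induces, so the
  -- polynomial is given by that map.
  IsPermutationPolynomial : (Carrier → Carrier) → Set (c ⊔ ℓ₁)
  IsPermutationPolynomial = FunctionDefinitions.Bijective _≈_ _≈_

  -- The trace onto the subfield of order q when F has order q ^ 2, its values
  -- being regarded as elements of F.
  Tr : ℕ → Carrier → Carrier
  Tr q x = x + x ^ q

  -- x + γ Tr(x⁴ + x^(q+3))
  f : ℕ → Carrier → Carrier → Carrier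
  f q γ x = x + γ * Tr q (x ^ 4 + x ^ (q ℕ.+ 3))

record FieldExtension (k : HeytingField c ℓ₁ ℓ₂) (K : HeytingField c′ ℓ₁′ ℓ₂′)
       : Set (c ⊔ ℓ₁ ⊔ c′ ⊔ ℓ₁′) where
  private
    module k = FieldNotions k
    module K = FieldNotions K
  field
    embed              : k.Carrier → K.Carrier
    isRingMonomorphism : IsRingMonomorphism k.rawRing K.rawRing embed

  InBaseField : K.Carrier → Set (c ⊔ ℓ₁′)
  InBaseField x = ∃[ a ] embed a K.≈ x

{-# OPTIONS --safe #-}

-- Write σ x = x^q and x = a + b with σ a = a, σ b = −b. Then the trace equals
-- 4a²(a² + 3b²), and f takes equal values at x and x + s as soon as the trace
-- changes by −s/γ.
--
-- Away from characteristic 3, for γ = c + δ ≠ 0 with σ c = c and σ δ = −δ, such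
-- a pair always exists. If δ ≠ 0, take s = γ and choose a with (a + c)² = a² ≠ 0;
-- the condition is then linear in b. If δ = 0, it reduces to representing a
-- nonzero fixed element as s² + 6b² with s ≠ 0. With κ² = −6 this form is
-- s² − (κb)², which is split or a norm according to σ κ = −κ or σ κ = κ.
--
-- In characteristic 3 the trace is (x + σ x)⁴, so f acts on x + σ x as
-- t ↦ t + (γ + σ γ) t⁴. Cubing is bijective, so this is injective only for
-- γ + σ γ = 0, which is the condition on αγ because σ α = −α.

module Submission where

open import Defs
open import Level using (Level; _⊔_)
open import Algebra.Apartness using (HeytingField)
open import Algebra.Bundles using (CommutativeRing)
open import Algebra.Morphism.Structures using (IsRingMonomorphism)
import Algebra.Properties.CommutativeMonoid.Sum as CommutativeMonoidSum
import Algebra.Properties.CommutativeSemiring.Binomial as Binomial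
import Algebra.Properties.CommutativeSemiring.Exp as Exp
import Algebra.Properties.Ring as RingProperties
import Algebra.Properties.Semiring.Mult as Mult
import Algebra.Properties.Semiring.Mult.TCOptimised as OptimisedMult
import Algebra.Properties.Semiring.Sum as SemiringSum
import Algebra.Solver.Ring as RingSolver
open import Algebra.Solver.Ring.AlmostCommutativeRing
  using (_-Raw-AlmostCommutative⟶_; fromCommutativeRing)
open import Data.Empty using (⊥-elim)
open import Data.Fin.Base as Fin using (Fin; zero; suc; fromℕ; inject₁; inject≤)
open import Data.Fin.Permutation using (Permutation′; permutation)
import Data.Fin.Properties as Fin
open import Data.Integer.Base as ℤ using (ℤ; +_; -[1+_]; _⊖_)
import Data.Integer.Properties as ℤ
open import Data.Maybe.Base using (Maybe; just; nothing)
open import Data.Nat.Base as ℕ using (ℕ; zero; suc; NonZero)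
open import Data.Nat.Combinatorics using (_C_; nCn≡1; nC1≡n; nCk+nC[k+1]≡[n+1]C[k+1])
open import Data.Nat.Divisibility as ℕ using (_∣_; divides)
import Data.Nat.DivMod as ℕ
open import Data.Nat.Primality as ℕ using (Prime; euclidsLemma)
import Data.Nat.Properties as ℕ
open import Data.Nat.Tactic.RingSolver using (solve-∀)
open import Data.Product.Base using (∃; ∃-syntax; Σ-syntax; _×_; _,_; proj₁; proj₂)
open import Data.Sum.Base using (_⊎_; inj₁; inj₂; [_,_]′)
open import Function.Base using (_∘_)
open import Function.Bundles using (Inverse; Equivalence; _⇔_; mk⇔)
open import Function.Definitions using (Injective)
open import Relation.Binary.Definitions using (Decidable; _Respects_)
open import Relation.Binary.PropositionalEquality as ≡ using (_≡_)
open import Relation.Nullary.Decidable as Dec using (Dec; yes; no)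
open import Relation.Nullary.Negation using (¬_; contradiction)
open import Relation.Unary as U using (Pred)

-- Whenever `f` has to fail to permute, it is injectivity that is refuted, by two explicit points.
-- Away from characteristic 3 this means solving equations in fixed and anti-fixed unknowns. The
-- base field is replaced throughout by the equation `σ x ≈ x` and is matched with it only at the
-- end, where the condition on αγ is read off.
--
-- The existence statements behind these solutions (a nonzero anti-fixed element, square roots of
-- fixed elements, surjectivity of the norm) are three instances of one fact: if km = q² - 1 and y^m
-- = 1, then y is a k-th power. It rests on counting roots rather than on a generator of the
-- multiplicative group, and q² - 1 = (q - 1)(q + 1) supplies the exponents.
--
-- The obstacle is a fixed γ. The linear equation that settles δ ≠ 0 has δ as a factor of the
-- coefficient of its unknown, so for δ = 0 it degenerates and a quadratic form has to be
-- represented instead. The representation must have s ≠ 0, because the two points differ by s.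

-- Ring identities with integer coefficients.

module IntegerSolver {c ℓ} (R : CommutativeRing c ℓ) where

  open CommutativeRing R
  open RingProperties ring
  open OptimisedMult semiring using (×-homo-+; ×1-homo-*; 1+×) renaming (_×_ to _·_)
  open import Relation.Binary.Reasoning.Setoid setoid

  private
    ℤ⟶R : ℤ → Carrier
    ℤ⟶R (+ n)    = n · 1#
    ℤ⟶R -[1+ n ] = - (suc n · 1#)

    cancel-1+ : ∀ x y → (1# + x) - (1# + y) ≈ x - y
    cancel-1+ x y = begin
      (1# + x) - (1# + y)         ≈⟨ +-cong (+-comm 1# x) (sym (-‿+-comm 1# y)) ⟩
      (x + 1#) + (- 1# - y)       ≈⟨ +-assoc x 1# _ ⟩
      x + (1# + (- 1# - y))       ≈⟨ +-congˡ (+-assoc 1# (- 1#) (- y)) ⟨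
      x + ((1# - 1#) - y)         ≈⟨ +-congˡ (+-congʳ (-‿inverseʳ 1#)) ⟩
      x + (0# - y)                ≈⟨ +-congˡ (+-identityˡ (- y)) ⟩
      x - y                       ∎

    ⊖-homo : ∀ m n → ℤ⟶R (m ⊖ n) ≈ m · 1# - n · 1#
    ⊖-homo m       zero    = sym (trans (+-congˡ -0#≈0#) (+-identityʳ _))
    ⊖-homo zero    (suc n) = sym (+-identityˡ _)
    ⊖-homo (suc m) (suc n) = begin
      ℤ⟶R (suc m ⊖ suc n)            ≡⟨ ≡.cong ℤ⟶R (ℤ.[1+m]⊖[1+n]≡m⊖n m n) ⟩
      ℤ⟶R (m ⊖ n)                    ≈⟨ ⊖-homo m n ⟩
      m · 1# - n · 1#                ≈⟨ cancel-1+ _ _ ⟨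
      (1# + m · 1#) - (1# + n · 1#)  ≈⟨ +-cong (1+× m 1#) (-‿cong (1+× n 1#)) ⟨
      suc m · 1# - suc n · 1#        ∎

    -‿homo : ∀ i → ℤ⟶R (ℤ.- i) ≈ - ℤ⟶R i
    -‿homo (+ zero)   = sym -0#≈0#
    -‿homo (+ suc n)  = refl
    -‿homo (-[1+ n ]) = sym (-‿involutive _)

    +-homo : ∀ i j → ℤ⟶R (i ℤ.+ j) ≈ ℤ⟶R i + ℤ⟶R j
    +-homo (+ m)    (+ n)    = ×-homo-+ 1# m n
    +-homo (+ m)    -[1+ n ] = ⊖-homo m (suc n)
    +-homo -[1+ m ] (+ n)    = trans (⊖-homo n (suc m)) (+-comm _ _)
    +-homo -[1+ m ] -[1+ n ] = begin
      - (suc (suc (m ℕ.+ n)) · 1#)         ≡⟨ ≡.cong (λ k → - (k · 1#)) (≡.cong suc (ℕ.+-suc m n)) ⟨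
      - ((suc m ℕ.+ suc n) · 1#)           ≈⟨ -‿cong (×-homo-+ 1# (suc m) (suc n)) ⟩
      - (suc m · 1# + suc n · 1#)          ≈⟨ -‿+-comm _ _ ⟨
      - (suc m · 1#) - suc n · 1#          ∎

    *-homo-pos : ∀ m n → ℤ⟶R (+ m ℤ.* + n) ≈ ℤ⟶R (+ m) * ℤ⟶R (+ n)
    *-homo-pos m n = trans (reflexive (≡.cong ℤ⟶R (≡.sym (ℤ.pos-* m n)))) (×1-homo-* m n)

    *-homo-posˡ : ∀ m j → ℤ⟶R (+ m ℤ.* j) ≈ ℤ⟶R (+ m) * ℤ⟶R j
    *-homo-posˡ m (+ n)    = *-homo-pos m n
    *-homo-posˡ m -[1+ n ] = begin
      ℤ⟶R (+ m ℤ.* ℤ.- (+ suc n))    ≡⟨ ≡.cong ℤ⟶R (ℤ.neg-distribʳ-* (+ m) (+ suc n)) ⟨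
      ℤ⟶R (ℤ.- (+ m ℤ.* + suc n))    ≈⟨ -‿homo (+ m ℤ.* + suc n) ⟩
      - ℤ⟶R (+ m ℤ.* + suc n)        ≈⟨ -‿cong (*-homo-pos m (suc n)) ⟩
      - (m · 1# * (suc n · 1#))      ≈⟨ -‿distribʳ-* _ _ ⟩
      m · 1# * - (suc n · 1#)        ∎

    *-homo : ∀ i j → ℤ⟶R (i ℤ.* j) ≈ ℤ⟶R i * ℤ⟶R j
    *-homo (+ m)    j = *-homo-posˡ m j
    *-homo -[1+ m ] j = begin
      ℤ⟶R (ℤ.- (+ suc m) ℤ.* j)      ≡⟨ ≡.cong ℤ⟶R (ℤ.neg-distribˡ-* (+ suc m) j) ⟨
      ℤ⟶R (ℤ.- (+ suc m ℤ.* j))      ≈⟨ -‿homo (+ suc m ℤ.* j) ⟩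
      - ℤ⟶R (+ suc m ℤ.* j)          ≈⟨ -‿cong (*-homo-posˡ (suc m) j) ⟩
      - (suc m · 1# * ℤ⟶R j)         ≈⟨ -‿distribˡ-* _ _ ⟩
      - (suc m · 1#) * ℤ⟶R j         ∎

    ℤ-homomorphism : ℤ.+-*-rawRing -Raw-AlmostCommutative⟶ fromCommutativeRing R
    ℤ-homomorphism = record
      { ⟦_⟧    = ℤ⟶R
      ; +-homo = +-homo
      ; *-homo = *-homo
      ; -‿homo = -‿homo
      ; 0-homo = refl
      ; 1-homo = refl
      }

    _≟ℤ_ : ∀ i j → Maybe (ℤ⟶R i ≈ ℤ⟶R j)
    i ≟ℤ j with i ℤ.≟ j
    ... | yes i≡j = just (reflexive (≡.cong ℤ⟶R i≡j))
    ... | no  _   = nothing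

  open RingSolver ℤ.+-*-rawRing (fromCommutativeRing R) ℤ-homomorphism _≟ℤ_ public
    using (solve; _:=_; _:+_; _:*_; _:-_; :-_; _:^_; con)

-- Binomial coefficients divisible by a prime.

[1+k]*[1+n]C[1+k]≡[1+n]*nCk : ∀ n k → suc k ℕ.* (suc n C suc k) ≡ suc n ℕ.* (n C k)
[1+k]*[1+n]C[1+k]≡[1+n]*nCk zero    zero    = ≡.refl
[1+k]*[1+n]C[1+k]≡[1+n]*nCk zero    (suc k) = ℕ.*-zeroʳ (suc (suc k))
[1+k]*[1+n]C[1+k]≡[1+n]*nCk (suc n) zero    =
  ≡.trans (ℕ.*-identityˡ _) (≡.trans (nC1≡n (suc (suc n))) (≡.sym (ℕ.*-identityʳ _)))
[1+k]*[1+n]C[1+k]≡[1+n]*nCk (suc n) (suc k) = begin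
  suc (suc k) ℕ.* (suc (suc n) C suc (suc k))
    ≡⟨ ≡.cong (suc (suc k) ℕ.*_) (nCk+nC[k+1]≡[n+1]C[k+1] (suc n) (suc k)) ⟨
  suc (suc k) ℕ.* ((suc n C suc k) ℕ.+ (suc n C suc (suc k)))
    ≡⟨ expand (suc n C suc k) (suc n C suc (suc k)) k ⟩
  (suc n C suc k) ℕ.+ (suc k ℕ.* (suc n C suc k) ℕ.+ suc (suc k) ℕ.* (suc n C suc (suc k)))
    ≡⟨ ≡.cong ((suc n C suc k) ℕ.+_)
         (≡.cong₂ ℕ._+_ ([1+k]*[1+n]C[1+k]≡[1+n]*nCk n k) ([1+k]*[1+n]C[1+k]≡[1+n]*nCk n (suc k))) ⟩
  (suc n C suc k) ℕ.+ (suc n ℕ.* (n C k) ℕ.+ suc n ℕ.* (n C suc k))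
    ≡⟨ ≡.cong ((suc n C suc k) ℕ.+_) (ℕ.*-distribˡ-+ (suc n) (n C k) (n C suc k)) ⟨
  (suc n C suc k) ℕ.+ suc n ℕ.* ((n C k) ℕ.+ (n C suc k))
    ≡⟨ ≡.cong (λ m → (suc n C suc k) ℕ.+ suc n ℕ.* m) (nCk+nC[k+1]≡[n+1]C[k+1] n k) ⟩
  suc (suc n) ℕ.* (suc n C suc k) ∎
  where
  open ≡.≡-Reasoning
  expand : ∀ a b k → suc (suc k) ℕ.* (a ℕ.+ b) ≡ a ℕ.+ (suc k ℕ.* a ℕ.+ suc (suc k) ℕ.* b)
  expand = solve-∀

-- The absorption identity makes `suc p` divide `suc k` times the coefficient, and the positive
-- number `suc k` is too small to be a multiple of `suc p`.
prime∣pC[1+k] : ∀ {p k} → Prime (suc p) → k ℕ.< p → suc p ∣ suc p C suc k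
prime∣pC[1+k] {p} {k} pr k<p
  with euclidsLemma (suc k) (suc p C suc k) pr
         (divides (p C k) (≡.trans ([1+k]*[1+n]C[1+k]≡[1+n]*nCk p k) (ℕ.*-comm (suc p) (p C k))))
... | inj₁ p∣1+k = contradiction (ℕ.∣⇒≤ p∣1+k) (ℕ.<⇒≱ (ℕ.s≤s k<p))
... | inj₂ p∣C   = p∣C

-- Additivity of the Frobenius map.

module Frobenius {c ℓ} (R : CommutativeRing c ℓ) where
  open CommutativeRing R hiding (zero)
  open Binomial commutativeSemiring using (binomial; binomialTerm; theorem)
  open Exp commutativeSemiring
  open Mult semiring using (×-assoc-*; ×-congʳ; ×-homo-1; ×1-homo-*) renaming (_×_ to _·_)
  open SemiringSum semiring using (sum; sum-init-last; sum-cong-≋; sum-replicate-zero)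
  open import Relation.Binary.Reasoning.Setoid setoid

  ∣⇒·≈0 : ∀ {m n} → m · 1# ≈ 0# → m ∣ n → ∀ x → n · x ≈ 0#
  ∣⇒·≈0 {m} {n} m·1≈0 (divides k ≡.refl) x = begin
    (k ℕ.* m) · x             ≈⟨ ×-congʳ (k ℕ.* m) (*-identityˡ x) ⟨
    (k ℕ.* m) · (1# * x)      ≈⟨ ×-assoc-* (k ℕ.* m) 1# x ⟨
    (k ℕ.* m) · 1# * x        ≈⟨ *-congʳ (×1-homo-* k m) ⟩
    (k · 1# * (m · 1#)) * x   ≈⟨ *-congʳ (*-congˡ m·1≈0) ⟩
    (k · 1# * 0#) * x         ≈⟨ *-congʳ (zeroʳ _) ⟩
    0# * x                    ≈⟨ zeroˡ x ⟩
    0#                        ∎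

  ^-·1 : ∀ m k → (m ℕ.^ k) · 1# ≈ (m · 1#) ^ k
  ^-·1 m zero    = ×-homo-1 1#
  ^-·1 m (suc k) = trans (×1-homo-* m (m ℕ.^ k)) (*-congˡ (^-·1 m k))

  module _ {p} (pr : Prime p) (p·1≈0 : p · 1# ≈ 0#) where

    prime-power-+ : ∀ x y → (x + y) ^ p ≈ x ^ p + y ^ p
    prime-power-+ x y = go p pr p·1≈0
      where
      go : ∀ p → Prime p → p · 1# ≈ 0# → (x + y) ^ p ≈ x ^ p + y ^ p
      go zero    pr p·1≈0 = contradiction pr ℕ.¬prime[0]
      go (suc p) pr p·1≈0 = begin
        (x + y) ^ suc p                                    ≈⟨ theorem (suc p) x y ⟩
        t zero + sum (λ i → t (suc i))                     ≈⟨ +-congˡ (sum-init-last (λ i → t (suc i))) ⟩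
        t zero + (sum (λ i → t (suc (inject₁ i))) + t (suc (fromℕ p)))
          ≈⟨ +-cong first (+-cong middle last) ⟩
        y ^ suc p + (0# + x ^ suc p)                       ≈⟨ +-congˡ (+-identityˡ _) ⟩
        y ^ suc p + x ^ suc p                              ≈⟨ +-comm _ _ ⟩
        x ^ suc p + y ^ suc p                              ∎
        where
        t : Fin (suc (suc p)) → Carrier
        t = binomialTerm x y (suc p)
        first : t zero ≈ y ^ suc p
        first = trans (×-homo-1 _) (*-identityˡ _)
        middle : sum (λ i → t (suc (inject₁ i))) ≈ 0#
        middle = trans (sum-cong-≋ {p} (λ i → ∣⇒·≈0 p·1≈0
          (prime∣pC[1+k] pr (≡.subst (ℕ._< p) (≡.sym (Fin.toℕ-inject₁ i)) (Fin.toℕ<n i)))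
          (binomial x y (suc p) (suc (inject₁ i))))) (sum-replicate-zero p)
        last : t (suc (fromℕ p)) ≈ x ^ suc p
        last rewrite Fin.toℕ-fromℕ p | nCn≡1 (suc p) | ℕ.n∸n≡0 p =
          trans (×-homo-1 _) (*-identityʳ _)

    prime-power-^-+ : ∀ k x y → (x + y) ^ (p ℕ.^ k) ≈ x ^ (p ℕ.^ k) + y ^ (p ℕ.^ k)
    prime-power-^-+ zero    x y =
      trans (*-identityʳ _) (sym (+-cong (*-identityʳ x) (*-identityʳ y)))
    prime-power-^-+ (suc k) x y = begin
      (x + y) ^ (p ℕ.* p ℕ.^ k)                      ≈⟨ ^-assocʳ (x + y) p (p ℕ.^ k) ⟨
      ((x + y) ^ p) ^ (p ℕ.^ k)                      ≈⟨ ^-congˡ (p ℕ.^ k) (prime-power-+ x y) ⟩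
      (x ^ p + y ^ p) ^ (p ℕ.^ k)                    ≈⟨ prime-power-^-+ k (x ^ p) (y ^ p) ⟩
      (x ^ p) ^ (p ℕ.^ k) + (y ^ p) ^ (p ℕ.^ k)
        ≈⟨ +-cong (^-assocʳ x p (p ℕ.^ k)) (^-assocʳ y p (p ℕ.^ k)) ⟩
      x ^ (p ℕ.* p ℕ.^ k) + y ^ (p ℕ.* p ℕ.^ k)      ∎

-- Polynomial functions and their leading coefficients.

module PolynomialFunctions {c ℓ} (R : CommutativeRing c ℓ) where
  open CommutativeRing R hiding (zero)
  open Exp commutativeSemiring using (_^_)
  open IntegerSolver R
  open import Relation.Binary.Reasoning.Setoid setoid

  -- `Polynomial d a f` says that f is induced by a polynomial of degree at
  -- most d whose coefficient at degree d is a: constants in degree 0, and in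
  -- degree d + 1 every quotient (f x − f y) / (x − y) is again polynomial in x.
  Polynomial : ℕ → Carrier → (Carrier → Carrier) → Set (c ⊔ ℓ)
  Polynomial zero    a f = Level.Lift c (∀ x → f x ≈ a)
  Polynomial (suc d) a f =
    ∀ y → Σ[ g ∈ (Carrier → Carrier) ] Polynomial d a g × (∀ x → f x ≈ f y + (x - y) * g x)

  Polynomial-resp : ∀ d {a b f g} → a ≈ b → (∀ x → f x ≈ g x) → Polynomial d a f → Polynomial d b g
  Polynomial-resp zero    a≈b f≈g (Level.lift f≈a) =
    Level.lift λ x → trans (sym (f≈g x)) (trans (f≈a x) a≈b)
  Polynomial-resp (suc d) a≈b f≈g P y =
    let h , H , f≈ = P y in
    h , Polynomial-resp d a≈b (λ _ → refl) H ,
    λ x → trans (sym (f≈g x)) (trans (f≈ x) (+-congʳ (f≈g y)))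

  Polynomial-+ : ∀ d {a b f g} → Polynomial d a f → Polynomial d b g →
                 Polynomial d (a + b) (λ x → f x + g x)
  Polynomial-+ zero    (Level.lift f≈a) (Level.lift g≈b) =
    Level.lift λ x → +-cong (f≈a x) (g≈b x)
  Polynomial-+ (suc d) {f = f} {g} P Q y =
    let f′ , P′ , f≈ = P y
        g′ , Q′ , g≈ = Q y in
    (λ x → f′ x + g′ x) , Polynomial-+ d P′ Q′ , λ x → trans (+-cong (f≈ x) (g≈ x))
      (solve 5 (λ a b t p q → (a :+ t :* p) :+ (b :+ t :* q) := (a :+ b) :+ t :* (p :+ q))
        refl (f y) (g y) (x - y) (f′ x) (g′ x))

  Polynomial-scale : ∀ d b {a f} → Polynomial d a f → Polynomial d (b * a) (λ x → b * f x)
  Polynomial-scale zero    b (Level.lift f≈a) = Level.lift λ x → *-congˡ (f≈a x)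
  Polynomial-scale (suc d) b {f = f} P y =
    let g , Q , f≈ = P y in
    (λ x → b * g x) , Polynomial-scale d b Q , λ x → trans (*-congˡ (f≈ x))
      (solve 4 (λ b a t p → b :* (a :+ t :* p) := b :* a :+ t :* (b :* p)) refl b (f y) (x - y) (g x))

  Polynomial-suc : ∀ d {a f} → Polynomial d a f → Polynomial (suc d) 0# f
  Polynomial-suc zero {f = f} (Level.lift f≈a) y =
    (λ _ → 0#) , Level.lift (λ _ → refl) ,
    λ x → trans (trans (f≈a x) (sym (f≈a y)))
      (solve 2 (λ a t → a := a :+ t :* con (+ 0)) refl (f y) (x - y))
  Polynomial-suc (suc d) P y = let g , Q , f≈ = P y in g , Polynomial-suc d Q , f≈

  Polynomial-< : ∀ {d e a f} → d ℕ.<′ e → Polynomial d a f → Polynomial e 0# f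
  Polynomial-< {d}         ℕ.<′-base         P = Polynomial-suc d P
  Polynomial-< {e = suc e} (ℕ.≤′-step d<e)   P = Polynomial-suc e (Polynomial-< d<e P)

  Polynomial-x* : ∀ d {a f} → Polynomial d a f → Polynomial (suc d) a (λ x → x * f x)
  Polynomial-x* zero {f = f} P@(Level.lift f≈a) y = f , P , λ x → begin
    x * f x              ≈⟨ solve 3 (λ x y p → x :* p := y :* p :+ (x :- y) :* p) refl x y (f x) ⟩
    y * f x + (x - y) * f x
      ≈⟨ +-congʳ (*-congˡ (trans (f≈a x) (sym (f≈a y)))) ⟩
    y * f y + (x - y) * f x   ∎
  Polynomial-x* (suc d) {a} {f} P y =
    let g , Q , f≈ = P y in
    -- The quotient of x f(x) - y f(y) by x - y. The term `y * g x` has lower degree than `f`, so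
    -- the leading coefficient remains that of `f`.
    (λ x → f x + y * g x) ,
    Polynomial-resp (suc d) (+-identityʳ a) (λ _ → refl)
      (Polynomial-+ (suc d) P (Polynomial-resp (suc d) refl (λ _ → refl)
        (Polynomial-suc d (Polynomial-scale d y Q)))) ,
    λ x → begin
      x * f x
        ≈⟨ solve 3 (λ x y p → x :* p := y :* p :+ (x :- y) :* p) refl x y (f x) ⟩
      y * f x + (x - y) * f x
        ≈⟨ +-congʳ (*-congˡ (f≈ x)) ⟩
      y * (f y + (x - y) * g x) + (x - y) * f x
        ≈⟨ solve 5 (λ y q t p g → y :* (q :+ t :* g) :+ t :* p := y :* q :+ t :* (p :+ y :* g))
             refl y (f y) (x - y) (f x) (g x) ⟩
      y * f y + (x - y) * (f x + y * g x) ∎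

  Polynomial-^ : ∀ d → Polynomial d 1# (_^ d)
  Polynomial-^ zero    = Level.lift λ _ → refl
  Polynomial-^ (suc d) = Polynomial-x* d (Polynomial-^ d)

-- Finite fields: decidability, x^n = x, and k-th roots.

module FiniteField {c ℓ₁ ℓ₂} (F : HeytingField c ℓ₁ ℓ₂) {n} (order : FieldNotions.HasOrder F n) where

  open CommutativeRing (FieldNotions.commutativeRing F) public hiding (zero)
  open Exp commutativeSemiring public
  open Mult semiring using () renaming (_×_ to _·_)
  open import Relation.Binary.Reasoning.Setoid setoid
  open HeytingField F using (tight; #⇒invertible; invertible⇒#; #-irrefl)
  open IntegerSolver (FieldNotions.commutativeRing F) public
  open PolynomialFunctions (FieldNotions.commutativeRing F) public
  open Inverse order

  private
    module Sum = CommutativeMonoidSum +-commutativeMonoid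
    module Product = CommutativeMonoidSum *-commutativeMonoid

  infix 4 _≟_
  _≟_ : Decidable _≈_
  x ≟ y = Dec.map′
    (λ eq → trans (sym (strictlyInverseʳ x)) (trans (from-cong eq) (strictlyInverseʳ y)))
    to-cong (to x Fin.≟ to y)

  search : ∀ {p} {P : Pred Carrier p} → P Respects _≈_ → U.Decidable P → Dec (∃ P)
  search resp P? = Dec.map′
    (λ (i , Pi) → from i , Pi)
    (λ (x , Px) → to x , resp (sym (strictlyInverseʳ x)) Px)
    (Fin.any? (P? ∘ from))

  1≉0 : ¬ (1# ≈ 0#)
  1≉0 1≈0 = #-irrefl {x = 1#} refl (invertible⇒# (0# , collapse _ _ , collapse _ _))
    where
    collapse : ∀ x y → x ≈ y
    collapse x y = begin
      x       ≈⟨ *-identityˡ x ⟨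
      1# * x  ≈⟨ *-congʳ 1≈0 ⟩
      0# * x  ≈⟨ trans (zeroˡ x) (sym (zeroˡ y)) ⟩
      0# * y  ≈⟨ *-congʳ 1≈0 ⟨
      1# * y  ≈⟨ *-identityˡ y ⟩
      y       ∎

  -- From x ≉ 0 alone apartness does not follow directly, so the inverse is searched for among the
  -- finitely many elements. A failed search refutes `x # 0#`, since apartness would give an
  -- inverse, and then `tight` yields x ≈ 0.
  inverse-of : ∀ {x} → ¬ (x ≈ 0#) → ∃[ y ] x * y ≈ 1#
  inverse-of {x} x≉0
    with search {P = λ y → x * y ≈ 1#} (λ y≈z → trans (*-congˡ (sym y≈z))) (λ y → x * y ≟ 1#)
  ... | yes found = found
  ... | no ¬found = contradiction (proj₁ (tight x 0#) λ x#0 →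
          let y , _ , [x-0]y≈1 = #⇒invertible x#0 in
          ¬found (y , trans (*-congʳ (solve 1 (λ x → x := x :- con (+ 0)) refl x)) [x-0]y≈1)) x≉0

  *-cancelˡ : ∀ {x y z} → ¬ (x ≈ 0#) → x * y ≈ x * z → y ≈ z
  *-cancelˡ {x} {y} {z} x≉0 xy≈xz = let w , xw≈1 = inverse-of x≉0 in begin
    y            ≈⟨ *-identityˡ y ⟨
    1# * y       ≈⟨ *-congʳ xw≈1 ⟨
    x * w * y    ≈⟨ solve 3 (λ x w y → x :* w :* y := w :* (x :* y)) refl x w y ⟩
    w * (x * y)  ≈⟨ *-congˡ xy≈xz ⟩
    w * (x * z)  ≈⟨ solve 3 (λ x w y → x :* w :* y := w :* (x :* y)) refl x w z ⟨
    x * w * z    ≈⟨ *-congʳ xw≈1 ⟩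
    1# * z       ≈⟨ *-identityˡ z ⟩
    z            ∎

  x*y≈0⇒y≈0 : ∀ {x y} → ¬ (x ≈ 0#) → x * y ≈ 0# → y ≈ 0#
  x*y≈0⇒y≈0 x≉0 xy≈0 = *-cancelˡ x≉0 (trans xy≈0 (sym (zeroʳ _)))

  *-≉0 : ∀ {x y} → ¬ (x ≈ 0#) → ¬ (y ≈ 0#) → ¬ (x * y ≈ 0#)
  *-≉0 x≉0 y≉0 xy≈0 = y≉0 (x*y≈0⇒y≈0 x≉0 xy≈0)

  integral : ∀ {x y} → x * y ≈ 0# → x ≈ 0# ⊎ y ≈ 0#
  integral {x} xy≈0 with x ≟ 0#
  ... | yes x≈0 = inj₁ x≈0
  ... | no  x≉0 = inj₂ (x*y≈0⇒y≈0 x≉0 xy≈0)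

  x^k≈0⇒x≈0 : ∀ k {x} → x ^ k ≈ 0# → x ≈ 0#
  x^k≈0⇒x≈0 zero    1≈0 = contradiction 1≈0 1≉0
  x^k≈0⇒x≈0 (suc k) x*x^k≈0 with integral x*x^k≈0
  ... | inj₁ x≈0   = x≈0
  ... | inj₂ x^k≈0 = x^k≈0⇒x≈0 k x^k≈0

  1^k≈1 : ∀ k → 1# ^ k ≈ 1#
  1^k≈1 zero    = refl
  1^k≈1 (suc k) = trans (*-identityˡ _) (1^k≈1 k)

  x-y≈0⇒x≈y : ∀ {x y} → x - y ≈ 0# → x ≈ y
  x-y≈0⇒x≈y {x} {y} x-y≈0 = begin
    x            ≈⟨ solve 2 (λ x y → x := (x :- y) :+ y) refl x y ⟩
    (x - y) + y  ≈⟨ +-congʳ x-y≈0 ⟩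
    0# + y       ≈⟨ +-identityˡ y ⟩
    y            ∎

  x≈y⇒x-y≈0 : ∀ {x y} → x ≈ y → x - y ≈ 0#
  x≈y⇒x-y≈0 x≈y = trans (+-congʳ x≈y) (-‿inverseʳ _)

  square-roots : ∀ {x y} → x * x ≈ y * y → x ≈ y ⊎ x ≈ - y
  square-roots {x} {y} xx≈yy with integral {x - y} {x + y}
    (trans (solve 2 (λ x y → (x :- y) :* (x :+ y) := x :* x :- y :* y) refl x y) (x≈y⇒x-y≈0 xx≈yy))
  ... | inj₁ x-y≈0 = inj₁ (x-y≈0⇒x≈y x-y≈0)
  ... | inj₂ x+y≈0 = inj₂ (x-y≈0⇒x≈y (trans (solve 2 (λ x y → x :- :- y := x :+ y) refl x y) x+y≈0))

  private
    reindex : (f g : Carrier → Carrier) → (∀ {x y} → x ≈ y → f x ≈ f y) → (∀ {x y} → x ≈ y → g x ≈ g y) →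
              (∀ x → f (g x) ≈ x) → (∀ x → g (f x) ≈ x) → Permutation′ n
    reindex f g f-cong g-cong fg gf = permutation (to ∘ f ∘ from) (to ∘ g ∘ from)
      (λ i → ≡.trans (to-cong (trans (f-cong (strictlyInverseʳ _)) (fg (from i)))) (strictlyInverseˡ i))
      (λ i → ≡.trans (to-cong (trans (g-cong (strictlyInverseʳ _)) (gf (from i)))) (strictlyInverseˡ i))

  -- Translation by `1#` permutes the field, so it preserves the sum of all elements while adding
  -- `1#` to that sum n times.
  order·1≈0 : n · 1# ≈ 0#
  order·1≈0 = begin
    n · 1#                       ≈⟨ Sum.sum-replicate n ⟨
    ones                         ≈⟨ solve 2 (λ o s → o := (o :+ s) :- s) refl ones elements ⟩
    (ones + elements) - elements ≈⟨ x≈y⇒x-y≈0 (sym shift) ⟩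
    0#                           ∎
    where
    ones elements : Carrier
    ones = Sum.sum {n} (λ _ → 1#)
    elements = Sum.sum from
    shift : elements ≈ ones + elements
    shift = begin
      elements
        ≈⟨ Sum.sum-permute from (reindex (λ x → 1# + x) (λ x → - 1# + x) +-congˡ +-congˡ
                                                 (λ x → solve 1 (λ x → con (+ 1) :+ (con -[1+ 0 ] :+ x)
                                                      := x) refl x)
                                                 (λ x → solve 1 (λ x → con -[1+ 0 ] :+ (con (+ 1) :+ x)
                                                      := x) refl x)) ⟩
      Sum.sum (from ∘ to ∘ (λ x → 1# + x) ∘ from)  ≈⟨ Sum.sum-cong-≋ (λ i → strictlyInverseʳ (1# + from i)) ⟩
      Sum.sum (λ i → 1# + from i)           ≈⟨ Sum.∑-distrib-+ (λ _ → 1#) from ⟩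
      ones + elements                       ∎

  private
    -- The extra factor `a` makes up for the one entry equal to `1#`, so the exponent is `m` and no
    -- subtraction occurs.
    product-of-all-but-one : ∀ {m} a (t : Fin m → Carrier) i → t i ≈ 1# → (∀ j → ¬ (j ≡ i) → t j ≈ a) →
                             Product.sum t * a ≈ a ^ m
    product-of-all-but-one {suc m} a t i ti≈1 tj≈a = begin
      Product.sum t * a                                  ≈⟨ *-congʳ (Product.sum-remove {i = i} t) ⟩
      t i * Product.sum (λ j → t (Fin.punchIn i j)) * a
        ≈⟨ *-congʳ (*-cong ti≈1 (trans
             (Product.sum-cong-≋ (λ j → tj≈a (Fin.punchIn i j) (Fin.punchInᵢ≢i i j)))
             (Product.sum-replicate m))) ⟩
      1# * a ^ m * a                                     ≈⟨ trans (*-congʳ (*-identityˡ _)) (*-comm _ _) ⟩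
      a * a ^ m                                          ∎

    product-≉0 : ∀ {m} (t : Fin m → Carrier) → (∀ i → ¬ (t i ≈ 0#)) → ¬ (Product.sum t ≈ 0#)
    product-≉0 {zero}  t t≉0 = 1≉0
    product-≉0 {suc m} t t≉0 = *-≉0 (t≉0 zero) (product-≉0 (t ∘ suc) (t≉0 ∘ suc))

    -- `unless-zero x x` replaces 0 by 1, so its product over the whole field is the product of the
    -- nonzero elements, with no index removed. `unless-zero x a` is the factor that multiplication
    -- by `a` contributes at `x`.
    unless-zero : Carrier → Carrier → Carrier
    unless-zero x y with x ≟ 0#
    ... | yes _ = 1#
    ... | no  _ = y

    unless-zero-0 : ∀ {x y} → x ≈ 0# → unless-zero x y ≈ 1#
    unless-zero-0 {x} x≈0 with x ≟ 0#
    ... | yes _   = refl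
    ... | no  x≉0 = contradiction x≈0 x≉0

    unless-zero-≉0 : ∀ {x y} → ¬ (x ≈ 0#) → unless-zero x y ≈ y
    unless-zero-≉0 {x} x≉0 with x ≟ 0#
    ... | yes x≈0 = contradiction x≈0 x≉0
    ... | no  _   = refl

    unless-zero-cong : ∀ {x y} → x ≈ y → unless-zero x x ≈ unless-zero y y
    unless-zero-cong {x} {y} x≈y with x ≟ 0#
    ... | yes x≈0 = sym (unless-zero-0 (trans (sym x≈y) x≈0))
    ... | no  x≉0 = trans x≈y (sym (unless-zero-≉0 (x≉0 ∘ trans x≈y)))

    unless-zero-* : ∀ a x → ¬ (a ≈ 0#) → unless-zero (a * x) (a * x) ≈ unless-zero x a * unless-zero x x
    unless-zero-* a x a≉0 with x ≟ 0#
    ... | yes x≈0 = trans (unless-zero-0 (trans (*-congˡ x≈0) (zeroʳ a))) (sym (*-identityˡ 1#))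
    ... | no  x≉0 = unless-zero-≉0 (*-≉0 a≉0 x≉0)

    unless-zero-nonzero : ∀ x → ¬ (unless-zero x x ≈ 0#)
    unless-zero-nonzero x with x ≟ 0#
    ... | yes _   = 1≉0
    ... | no  x≉0 = x≉0

  -- Multiplication by a ≉ 0 permutes the field, so it fixes the product of all
  -- nonzero elements.
  x^order≈x : ∀ x → x ^ n ≈ x
  x^order≈x a with a ≟ 0#
  ... | yes a≈0 = begin
    a ^ n   ≈⟨ ^-congˡ n a≈0 ⟩
    0# ^ n  ≈⟨ 0^m≈0 (to 0#) ⟩
    0#      ≈⟨ a≈0 ⟨
    a       ∎
    where
    -- An element of `Fin m` witnesses that the exponent is positive; `to 0#` is such an element for
    -- `n`.
    0^m≈0 : ∀ {m} → Fin m → 0# ^ m ≈ 0#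
    0^m≈0 {suc m} _ = zeroˡ (0# ^ m)
  ... | no a≉0 = begin
    a ^ n              ≈⟨ product-of-all-but-one a (λ i → unless-zero (from i) a) (to 0#)
                            (unless-zero-0 (strictlyInverseʳ 0#))
                            (λ i i≢0 → unless-zero-≉0 (λ from≈0 →
                              i≢0 (≡.trans (≡.sym (strictlyInverseˡ i)) (to-cong from≈0)))) ⟨
    scalars * a        ≈⟨ *-congʳ scalars≈1 ⟩
    1# * a             ≈⟨ *-identityˡ a ⟩
    a                  ∎
    where
    a⁻¹ : Carrier
    a⁻¹ = proj₁ (inverse-of a≉0)
    scale-unscale : ∀ x → a * (a⁻¹ * x) ≈ x
    scale-unscale x = trans (sym (*-assoc a a⁻¹ x)) (trans (*-congʳ (proj₂ (inverse-of a≉0))) (*-identityˡ x))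
    unscale-scale : ∀ x → a⁻¹ * (a * x) ≈ x
    unscale-scale x = trans (solve 3 (λ a b x → b :* (a :* x)
         := a :* (b :* x)) refl a a⁻¹ x) (scale-unscale x)
    scalars elements : Carrier
    scalars = Product.sum (λ i → unless-zero (from i) a)
    elements = Product.sum (λ i → unless-zero (from i) (from i))
    elements≈ : elements ≈ scalars * elements
    elements≈ = begin
      elements
        ≈⟨ Product.sum-permute _ (reindex (a *_) (a⁻¹ *_) *-congˡ *-congˡ scale-unscale unscale-scale) ⟩
      Product.sum (λ i → unless-zero (from (to (a * from i))) (from (to (a * from i))))
        ≈⟨ Product.sum-cong-≋ (λ i → trans (unless-zero-cong (strictlyInverseʳ (a * from i))) (unless-zero-* a (from i) a≉0)) ⟩
      Product.sum (λ i → unless-zero (from i) a * unless-zero (from i) (from i))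
        ≈⟨ Product.∑-distrib-+ (λ i → unless-zero (from i) a) (λ i → unless-zero (from i) (from i)) ⟩
      scalars * elements ∎
    scalars≈1 : scalars ≈ 1#
    scalars≈1 = *-cancelˡ {elements}
      (product-≉0 {n} _ (λ i → unless-zero-nonzero (from i)))
      (trans (*-comm elements scalars) (trans (sym elements≈) (sym (*-identityʳ elements))))

  x^[order-1]≈1 : ∀ {m} → suc m ≡ n → ∀ {x} → ¬ (x ≈ 0#) → x ^ m ≈ 1#
  x^[order-1]≈1 ≡.refl {x} x≉0 = *-cancelˡ x≉0 (trans (x^order≈x x) (sym (*-identityʳ x)))

  -- Splitting off the first root leaves a quotient of lower degree with the same leading
  -- coefficient. The other roots are distinct from the first, so they are roots of the quotient.
  leading-coefficient≈0 : ∀ d {a f} → Polynomial d a f → (r : Fin (suc d) → Carrier) →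
                          (∀ {i j} → r i ≈ r j → i ≡ j) → (∀ i → f (r i) ≈ 0#) → a ≈ 0#
  leading-coefficient≈0 zero    (Level.lift f≈a) r r-inj root = trans (sym (f≈a (r zero))) (root zero)
  leading-coefficient≈0 (suc d) {f = f} P r r-inj root =
    let g , Q , f≈ = P (r zero) in
    leading-coefficient≈0 d Q (r ∘ suc) (Fin.suc-injective ∘ r-inj) λ i →
    x*y≈0⇒y≈0 {r (suc i) - r zero}
      (λ eq → case-≡ (r-inj (x-y≈0⇒x≈y eq)))
      (begin
        (r (suc i) - r zero) * g (r (suc i))                ≈⟨ +-identityˡ _ ⟨
        0# + (r (suc i) - r zero) * g (r (suc i))           ≈⟨ +-congʳ (root zero) ⟨
        f (r zero) + (r (suc i) - r zero) * g (r (suc i))   ≈⟨ f≈ (r (suc i)) ⟨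
        f (r (suc i))                                       ≈⟨ root (suc i) ⟩
        0#                                                  ∎)
    where
    case-≡ : ∀ {m} {i : Fin m} → ¬ (Fin.suc i ≡ zero)
    case-≡ ()

  leading-coefficient-of-zero : ∀ {d a f} → d ℕ.< n → Polynomial d a f → (∀ x → f x ≈ 0#) → a ≈ 0#
  leading-coefficient-of-zero {d} d<n P f≈0 =
    leading-coefficient≈0 d P (λ i → from (inject≤ i d<n))
      (λ eq → Fin.inject≤-injective d<n d<n _ _ (≡.trans (≡.sym (strictlyInverseˡ _))
        (≡.trans (to-cong eq) (strictlyInverseˡ _))))
      (λ _ → f≈0 _)

  private
    -- The sum of all x^i y^(m-1-i), that is (x^m - y^m) / (x - y), in a form that makes sense at x
    -- = y as well.
    quotient : Carrier → ℕ → Carrier → Carrier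
    quotient y zero    x = 0#
    quotient y (suc m) x = x ^ m + y * quotient y m x

    quotient-spec : ∀ y m x → (x - y) * quotient y m x ≈ x ^ m - y ^ m
    quotient-spec y zero    x = solve 2 (λ x y → (x :- y) :* con (+ 0) := con (+ 1) :- con (+ 1)) refl x y
    quotient-spec y (suc m) x = begin
      (x - y) * (x ^ m + y * quotient y m x)
        ≈⟨ solve 4 (λ x y p h → (x :- y) :* (p :+ y :* h) := (x :- y) :* p :+ y :* ((x :- y) :* h))
             refl x y (x ^ m) (quotient y m x) ⟩
      (x - y) * x ^ m + y * ((x - y) * quotient y m x)
        ≈⟨ +-congˡ (*-congˡ (quotient-spec y m x)) ⟩
      (x - y) * x ^ m + y * (x ^ m - y ^ m)
        ≈⟨ solve 4 (λ x y p r → (x :- y) :* p :+ y :* (p :- r) := x :* p :- y :* r) refl x y (x ^ m) (y ^ m) ⟩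
      x ^ suc m - y ^ suc m ∎

    quotient-Polynomial : ∀ k .{{_ : NonZero k}} y m →
                          Polynomial (k ℕ.* m) 1# (λ x → quotient y (suc m) (x ^ k))
    quotient-Polynomial k y zero = ≡.subst (λ d → Polynomial d 1# (λ x → quotient y 1 (x ^ k)))
      (≡.sym (ℕ.*-zeroʳ k))
      (Level.lift λ _ → trans (+-congˡ (zeroʳ y)) (+-identityʳ 1#))
    quotient-Polynomial k y (suc m) = Polynomial-resp (k ℕ.* suc m) (+-identityʳ 1#)
      (λ x → +-congʳ (sym (^-assocʳ x k (suc m))))
      (Polynomial-+ (k ℕ.* suc m) (Polynomial-^ (k ℕ.* suc m))
        (Polynomial-< (ℕ.<⇒<′ (ℕ.*-monoʳ-< k (ℕ.n<1+n m)))
          (Polynomial-scale (k ℕ.* m) y (quotient-Polynomial k y m))))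

  -- If y were not a k-th power, x (x^km − y^m) / (x^k − y) would vanish
  -- identically although its degree k (m − 1) + 1 is less than the order.
  kth-root : ∀ k m .{{_ : NonZero k}} {y} → suc (k ℕ.* m) ≡ n → y ^ m ≈ 1# → ∃[ x ] x ^ k ≈ y
  -- For m = 0 the order would be 1, forcing 0 and 1 to coincide.
  kth-root k zero {y} ≡.refl _ = contradiction 1≈0 1≉0
    where
    Fin1 : ∀ {l} → l ≡ 0 → (i j : Fin (suc l)) → i ≡ j
    Fin1 ≡.refl zero zero = ≡.refl
    1≈0 : 1# ≈ 0#
    1≈0 = trans (sym (strictlyInverseʳ 1#))
            (trans (from-cong (Fin1 (ℕ.*-zeroʳ k) (to 1#) (to 0#))) (strictlyInverseʳ 0#))
  kth-root k (suc m) {y} 1+km≡n y^m≈1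
    with search {P = λ x → x ^ k ≈ y} (λ x≈z → trans (^-congˡ k (sym x≈z))) (λ x → x ^ k ≟ y)
  ... | yes found = found
  ... | no ¬found = contradiction
    (leading-coefficient-of-zero
      (≡.subst (suc (k ℕ.* m) ℕ.<_) 1+km≡n (ℕ.s<s (ℕ.*-monoʳ-< k (ℕ.n<1+n m))))
      (Polynomial-x* (k ℕ.* m) (quotient-Polynomial k y m)) vanishes)
    1≉0
    where
    vanishes : ∀ x → x * quotient y (suc m) (x ^ k) ≈ 0#
    vanishes x with x ≟ 0#
    ... | yes x≈0 = trans (*-congʳ x≈0) (zeroˡ _)
    ... | no  x≉0 = trans (*-congˡ (x*y≈0⇒y≈0 {x ^ k - y} (λ eq → ¬found (x , x-y≈0⇒x≈y eq)) (begin
      (x ^ k - y) * quotient y (suc m) (x ^ k)  ≈⟨ quotient-spec y (suc m) (x ^ k) ⟩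
      (x ^ k) ^ suc m - y ^ suc m               ≈⟨ x≈y⇒x-y≈0 (trans (^-assocʳ x k (suc m))
                                                     (trans (x^[order-1]≈1 1+km≡n x≉0) (sym y^m≈1))) ⟩
      0#                                        ∎))) (zeroʳ x)

-- Conjugation on the quadratic extension; fixed and anti-fixed elements.

2≤primePower : ∀ {q} → IsPrimePower q → 2 ℕ.≤ q
2≤primePower (p , suc k , pr , _ , ≡.refl) =
  ℕ.≤-trans (ℕ.nonTrivial⇒n>1 p {{ℕ.prime⇒nonTrivial pr}})
            (ℕ.m≤m*n p (p ℕ.^ k) {{ℕ.m^n≢0 p k {{ℕ.prime⇒nonZero pr}}}})

odd⇒1+2k : ∀ {q} → ¬ (2 ∣ q) → ∃[ k ] q ≡ suc (k ℕ.* 2)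
odd⇒1+2k {q} 2∤q with q ℕ.% 2 in eq | ℕ.m%n<n q 2 | ℕ.m≡m%n+[m/n]*n q 2
... | 0 | _ | _      = contradiction (ℕ.m%n≡0⇒n∣m q 2 eq) 2∤q
... | 1 | _ | q≡     = q ℕ./ 2 , q≡
... | suc (suc _) | ℕ.s<s (ℕ.s<s ()) | _

module QuadraticExtension {c ℓ₁ ℓ₂} (K : HeytingField c ℓ₁ ℓ₂) {q} (q-primePower : IsPrimePower q)
         (2∤q : ¬ (2 ∣ q)) (order : FieldNotions.HasOrder K (q ℕ.^ 2)) where

  open FieldNotions K using (Tr; f; HasCharacteristic; IsPermutationPolynomial)
  open FiniteField K order public
  open Frobenius (FieldNotions.commutativeRing K)
  open RingProperties ring
  open Mult semiring using (×-congˡ) renaming (_×_ to _·_)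
  open import Relation.Binary.Reasoning.Setoid setoid

  -- Nested to the left so that the solver constants `con (+ 2)`, `con (+ 3)` and `con (+ 4)`
  -- evaluate to them definitionally.
  2# 3# 4# : Carrier
  2# = 1# + 1#
  3# = 2# + 1#
  4# = 3# + 1#

  private
    j : ℕ
    j = proj₁ (odd⇒1+2k 2∤q)

    q≡1+2j : q ≡ suc (j ℕ.* 2)
    q≡1+2j = proj₂ (odd⇒1+2k 2∤q)

    j≢0 : NonZero j
    j≢0 = ℕ.≢-nonZero λ j≡0 → contradiction
      (≡.subst (2 ℕ.≤_) (≡.trans q≡1+2j (≡.cong (λ i → suc (i ℕ.* 2)) j≡0)) (2≤primePower q-primePower))
      λ { (ℕ.s≤s ()) }

  q·1≈0 : q · 1# ≈ 0#
  q·1≈0 = x^k≈0⇒x≈0 2 (trans (sym (^-·1 q 2)) order·1≈0)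

  -- If 2 were 0, the odd multiple `q · 1#` would equal `1#`, but it vanishes.
  2≉0 : ¬ (2# ≈ 0#)
  2≉0 2≈0 = 1≉0 (begin
    1#                     ≈⟨ +-identityʳ 1# ⟨
    1# + 0#
      ≈⟨ +-congˡ (∣⇒·≈0 {2} {j ℕ.* 2} (trans (+-congˡ (+-identityʳ 1#)) 2≈0) (divides j ≡.refl) 1#) ⟨
    suc (j ℕ.* 2) · 1#     ≈⟨ ×-congˡ q≡1+2j ⟨
    q · 1#                 ≈⟨ q·1≈0 ⟩
    0#                     ∎)

  half : Carrier → Carrier
  half x = proj₁ (inverse-of 2≉0) * x

  half+half : ∀ x → half x + half x ≈ x
  half+half x = let h , 2h≈1 = inverse-of 2≉0 in begin
    h * x + h * x        ≈⟨ solve 2 (λ h x → h :* x :+ h :* x := con (+ 2) :* h :* x) refl h x ⟩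
    2# * h * x           ≈⟨ *-congʳ 2h≈1 ⟩
    1# * x               ≈⟨ *-identityˡ x ⟩
    x                    ∎

  double-injective : ∀ {x y} → x + x ≈ y + y → x ≈ y
  double-injective {x} {y} eq = *-cancelˡ 2≉0 (begin
    2# * x  ≈⟨ solve 1 (λ x → con (+ 2) :* x := x :+ x) refl x ⟩
    x + x   ≈⟨ eq ⟩
    y + y   ≈⟨ solve 1 (λ x → con (+ 2) :* x := x :+ x) refl y ⟨
    2# * y  ∎)

  σ : Carrier → Carrier
  σ x = x ^ q

  σ-cong : ∀ {x y} → x ≈ y → σ x ≈ σ y
  σ-cong = ^-congˡ q

  σ-+ : ∀ x y → σ (x + y) ≈ σ x + σ y
  σ-+ = go q-primePower q·1≈0
    where
    go : ∀ {q} → IsPrimePower q → q · 1# ≈ 0# → ∀ x y → (x + y) ^ q ≈ x ^ q + y ^ q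
    go (p , k , pr , _ , ≡.refl) q·1≈0 =
      -- `q · 1#` is the k-th power of `p · 1#`, so the latter vanishes too and the p-th power map
      -- is additive.
      prime-power-^-+ pr (x^k≈0⇒x≈0 k (trans (sym (^-·1 p k)) q·1≈0)) k

  σ-* : ∀ x y → σ (x * y) ≈ σ x * σ y
  σ-* x y = ^-distrib-* x y q

  σ-^ : ∀ x m → σ (x ^ m) ≈ σ x ^ m
  σ-^ x m = begin
    (x ^ m) ^ q      ≈⟨ ^-assocʳ x m q ⟩
    x ^ (m ℕ.* q)    ≈⟨ ^-congʳ x (ℕ.*-comm m q) ⟩
    x ^ (q ℕ.* m)    ≈⟨ ^-assocʳ x q m ⟨
    (x ^ q) ^ m      ∎

  σ-involutive : ∀ x → σ (σ x) ≈ x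
  σ-involutive x = begin
    (x ^ q) ^ q            ≈⟨ ^-assocʳ x q q ⟩
    x ^ (q ℕ.* q)          ≈⟨ ^-congʳ x (≡.cong (q ℕ.*_) (≡.sym (ℕ.*-identityʳ q))) ⟩
    x ^ (q ℕ.^ 2)          ≈⟨ x^order≈x x ⟩
    x                      ∎

  Fixed Anti : Carrier → Set ℓ₁
  Fixed x = σ x ≈ x
  Anti x = σ x ≈ - x

  Fixed-resp : ∀ {x y} → x ≈ y → Fixed x → Fixed y
  Fixed-resp x≈y σx = trans (σ-cong (sym x≈y)) (trans σx x≈y)

  Fixed-1 : Fixed 1#
  Fixed-1 = 1^k≈1 q

  Fixed-+ : ∀ {x y} → Fixed x → Fixed y → Fixed (x + y)
  Fixed-+ σx σy = trans (σ-+ _ _) (+-cong σx σy)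

  Fixed-* : ∀ {x y} → Fixed x → Fixed y → Fixed (x * y)
  Fixed-* σx σy = trans (σ-* _ _) (*-cong σx σy)

  σ-0 : Fixed 0#
  σ-0 = begin
    σ 0#                   ≈⟨ solve 1 (λ x → x := (x :+ x) :- x) refl (σ 0#) ⟩
    (σ 0# + σ 0#) - σ 0#   ≈⟨ +-congʳ (σ-+ 0# 0#) ⟨
    σ (0# + 0#) - σ 0#     ≈⟨ x≈y⇒x-y≈0 (σ-cong (+-identityˡ 0#)) ⟩
    0#                     ∎

  σ-neg : ∀ x → σ (- x) ≈ - σ x
  σ-neg x = begin
    σ (- x)                 ≈⟨ solve 2 (λ y z → y := (z :+ y) :- z) refl (σ (- x)) (σ x) ⟩
    (σ x + σ (- x)) - σ x   ≈⟨ +-congʳ (σ-+ x (- x)) ⟨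
    σ (x - x) - σ x         ≈⟨ +-congʳ (trans (σ-cong (-‿inverseʳ x)) σ-0) ⟩
    0# - σ x                ≈⟨ +-identityˡ _ ⟩
    - σ x                   ∎

  Fixed-neg : ∀ {x} → Fixed x → Fixed (- x)
  Fixed-neg σx = trans (σ-neg _) (-‿cong σx)

  Anti-neg : ∀ {x} → Anti x → Anti (- x)
  Anti-neg σx = trans (σ-neg _) (-‿cong σx)

  Anti-+ : ∀ {x y} → Anti x → Anti y → Anti (x + y)
  Anti-+ σx σy = trans (σ-+ _ _) (trans (+-cong σx σy) (-‿+-comm _ _))

  Fixed*Anti : ∀ {x y} → Fixed x → Anti y → Anti (x * y)
  Fixed*Anti σx σy = trans (σ-* _ _) (trans (*-cong σx σy) (sym (-‿distribʳ-* _ _)))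

  Anti*Anti : ∀ {x y} → Anti x → Anti y → Fixed (x * y)
  Anti*Anti {x} {y} σx σy = trans (σ-* x y) (trans (*-cong σx σy)
    (solve 2 (λ x y → (:- x) :* (:- y) := x :* y) refl x y))

  Fixed-2 : Fixed 2#
  Fixed-2 = Fixed-+ Fixed-1 Fixed-1

  Fixed-3 : Fixed 3#
  Fixed-3 = Fixed-+ Fixed-2 Fixed-1

  Fixed-4 : Fixed 4#
  Fixed-4 = Fixed-+ Fixed-3 Fixed-1

  Fixed∧Anti⇒≈0 : ∀ {x} → Fixed x → Anti x → x ≈ 0#
  Fixed∧Anti⇒≈0 {x} σx σ-x = double-injective (begin
    x + x    ≈⟨ +-congˡ (trans (sym σx) σ-x) ⟩
    x - x    ≈⟨ solve 1 (λ x → x :- x := con (+ 0) :+ con (+ 0)) refl x ⟩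
    0# + 0#  ∎)

  unit≉0 : ∀ {x y} → x * y ≈ 1# → ¬ (x ≈ 0#)
  unit≉0 xy≈1 x≈0 = 1≉0 (trans (sym xy≈1) (trans (*-congʳ x≈0) (zeroˡ _)))

  Fixed-inverse : ∀ {x y} → x * y ≈ 1# → Fixed x → Fixed y
  Fixed-inverse {x} {y} xy≈1 σx = *-cancelˡ (unit≉0 xy≈1) (begin
    x * σ y    ≈⟨ *-congʳ σx ⟨
    σ x * σ y  ≈⟨ σ-* x y ⟨
    σ (x * y)  ≈⟨ trans (σ-cong xy≈1) Fixed-1 ⟩
    1#         ≈⟨ xy≈1 ⟨
    x * y      ∎)

  Anti-inverse : ∀ {x y} → x * y ≈ 1# → Anti x → Anti y
  Anti-inverse {x} {y} xy≈1 σx = *-cancelˡ (unit≉0 xy≈1) (begin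
    x * σ y        ≈⟨ solve 2 (λ x z → x :* z := :- ((:- x) :* z)) refl x (σ y) ⟩
    - (- x * σ y)  ≈⟨ -‿cong (*-congʳ σx) ⟨
    - (σ x * σ y)  ≈⟨ -‿cong (σ-* x y) ⟨
    - σ (x * y)    ≈⟨ -‿cong (trans (σ-cong xy≈1) Fixed-1) ⟩
    - 1#           ≈⟨ -‿cong xy≈1 ⟨
    - (x * y)      ≈⟨ -‿distribʳ-* x y ⟩
    x * - y        ∎)

  Fixed-half : ∀ {x} → Fixed x → Fixed (half x)
  Fixed-half = Fixed-* (Fixed-inverse (proj₂ (inverse-of 2≉0)) Fixed-2)

  Anti-half : ∀ {x} → Anti x → Anti (half x)
  Anti-half = Fixed*Anti (Fixed-inverse (proj₂ (inverse-of 2≉0)) Fixed-2)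

  Fixed-trace : ∀ x → Fixed (x + σ x)
  Fixed-trace x = trans (σ-+ x (σ x)) (trans (+-congˡ (σ-involutive x)) (+-comm (σ x) x))

  Anti-cotrace : ∀ x → Anti (x - σ x)
  Anti-cotrace x = begin
    σ (x - σ x)       ≈⟨ trans (σ-+ x (- σ x)) (+-congˡ (trans (σ-neg (σ x)) (-‿cong (σ-involutive x)))) ⟩
    σ x - x           ≈⟨ solve 2 (λ x y → y :- x := :- (x :- y)) refl x (σ x) ⟩
    - (x - σ x)       ∎

  decompose : ∀ x → ∃[ a ] ∃[ b ] Fixed a × Anti b × x ≈ a + b
  decompose x = half (x + σ x) , half (x - σ x) , Fixed-half (Fixed-trace x) , Anti-half (Anti-cotrace x) ,
    (begin
      x                                  ≈⟨ half+half x ⟨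
      half x + half x
        ≈⟨ solve 3 (λ h x y → h :* x :+ h :* x := h :* (x :+ y) :+ h :* (x :- y))
                                              refl (proj₁ (inverse-of 2≉0)) x (σ x) ⟩
      half (x + σ x) + half (x - σ x)    ∎)

  σ-decomposed : ∀ {x a b} → Fixed a → Anti b → x ≈ a + b → σ x ≈ a - b
  σ-decomposed σa σb x≈a+b = trans (σ-cong x≈a+b) (trans (σ-+ _ _) (+-cong σa σb))

  -- The trace term in fixed and anti-fixed coordinates.

  tr : Carrier → Carrier
  tr x = Tr q (x ^ 4 + x ^ (q ℕ.+ 3))

  tr-cong : ∀ {x y} → x ≈ y → tr x ≈ tr y
  tr-cong x≈y = +-cong eq (σ-cong eq)
    where eq = +-cong (^-congˡ 4 x≈y) (^-congˡ (q ℕ.+ 3) x≈y)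

  f-cong : ∀ γ {x y} → x ≈ y → f q γ x ≈ f q γ y
  f-cong γ x≈y = +-cong x≈y (*-congˡ (tr-cong x≈y))

  tr-expand : ∀ x → tr x ≈ (x ^ 4 + σ x * x ^ 3) + (σ x ^ 4 + x * σ x ^ 3)
  tr-expand x = +-cong eq (begin
    σ (x ^ 4 + x ^ (q ℕ.+ 3))            ≈⟨ σ-cong eq ⟩
    σ (x ^ 4 + σ x * x ^ 3)              ≈⟨ σ-+ (x ^ 4) (σ x * x ^ 3) ⟩
    σ (x ^ 4) + σ (σ x * x ^ 3)
      ≈⟨ +-cong (σ-^ x 4) (trans (σ-* (σ x) (x ^ 3)) (*-cong (σ-involutive x) (σ-^ x 3))) ⟩
    σ x ^ 4 + x * σ x ^ 3                ∎)
    where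
    eq : x ^ 4 + x ^ (q ℕ.+ 3) ≈ x ^ 4 + σ x * x ^ 3
    eq = +-congˡ (^-homo-* x q 3)

  tr-decomposed : ∀ {x a b} → Fixed a → Anti b → x ≈ a + b →
                  tr x ≈ 4# * (a * a) * (a * a + 3# * (b * b))
  tr-decomposed {x} {a} {b} σa σb x≈a+b = begin
    tr x                                                       ≈⟨ tr-expand x ⟩
    (x ^ 4 + σ x * x ^ 3) + (σ x ^ 4 + x * σ x ^ 3)
      ≈⟨ +-cong (+-cong (^-congˡ 4 x≈a+b) (*-cong σx≈a-b (^-congˡ 3 x≈a+b)))
                (+-cong (^-congˡ 4 σx≈a-b) (*-cong x≈a+b (^-congˡ 3 σx≈a-b))) ⟩
    ((a + b) ^ 4 + (a - b) * (a + b) ^ 3) + ((a - b) ^ 4 + (a + b) * (a - b) ^ 3)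
      ≈⟨ solve 2 (λ a b → (((a :+ b) :^ 4) :+ (a :- b) :* ((a :+ b) :^ 3)) :+ (((a :- b) :^ 4) :+ (a :+ b) :* ((a :- b) :^ 3))
                     := con (+ 4) :* (a :* a) :* (a :* a :+ con (+ 3) :* (b :* b))) refl a b ⟩
    4# * (a * a) * (a * a + 3# * (b * b))                      ∎
    where
    σx≈a-b : σ x ≈ a - b
    σx≈a-b = σ-decomposed σa σb x≈a+b

  collision⇒¬injective : ∀ {γ x s} → ¬ (s ≈ 0#) → s + γ * tr (x + s) ≈ γ * tr x →
                         ¬ Injective _≈_ _≈_ (f q γ)
  collision⇒¬injective {γ} {x} {s} s≉0 eq inj = s≉0 (begin
    s            ≈⟨ solve 2 (λ x s → s := (x :+ s) :- x) refl x s ⟩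
    (x + s) - x  ≈⟨ x≈y⇒x-y≈0 (inj (trans (+-assoc x s _) (+-congˡ eq))) ⟩
    0#           ∎)

  -- Roots supplied by the factorization of q² - 1.

  private
    -- With q = 1 + 2j the right-hand product is (q - 1)(q + 1), so every factorization km of it
    -- fits the order hypothesis of `kth-root`.
    1+2j-order : ∀ k m → k ℕ.* m ≡ (j ℕ.* 2) ℕ.* (2 ℕ.+ j ℕ.* 2) → suc (k ℕ.* m) ≡ q ℕ.^ 2
    1+2j-order _ _ eq = ≡.trans (≡.cong suc eq) (≡.trans (square j) (≡.cong (ℕ._^ 2) (≡.sym q≡1+2j)))
      where
      square : ∀ j → suc ((j ℕ.* 2) ℕ.* (2 ℕ.+ j ℕ.* 2)) ≡ suc (j ℕ.* 2) ℕ.* (suc (j ℕ.* 2) ℕ.* 1)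
      square = solve-∀

    σ≈x*x^2j : ∀ x → σ x ≈ x * x ^ (j ℕ.* 2)
    σ≈x*x^2j x = ^-congʳ x q≡1+2j

    Fixed⇒x^2j≈1 : ∀ {x} → ¬ (x ≈ 0#) → Fixed x → x ^ (j ℕ.* 2) ≈ 1#
    Fixed⇒x^2j≈1 {x} x≉0 σx = *-cancelˡ x≉0 (trans (sym (σ≈x*x^2j x)) (trans σx (sym (*-identityʳ x))))

  -- For v ≠ 0 the condition reads v^(q-1) = -1. As q + 1 is even, (-1)^(q+1) = 1, which makes -1 a
  -- (q-1)-th power.
  nonzero-anti : ∃[ v ] Anti v × ¬ (v ≈ 0#)
  nonzero-anti =
    let instance
          _ = j≢0
          _ = ℕ.m*n≢0 j 2
        v , v^2j≈-1 = kth-root (j ℕ.* 2) (2 ℕ.+ j ℕ.* 2) (1+2j-order (j ℕ.* 2) (2 ℕ.+ j ℕ.* 2) ≡.refl) [-1]^[2+2j]≈1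
    in v
     , trans (σ≈x*x^2j v) (trans (*-congˡ v^2j≈-1) (solve 1 (λ v → v :* con -[1+ 0 ] := :- v) refl v))
     , λ v≈0 → 1≉0 (begin
         1#                    ≈⟨ -‿involutive 1# ⟨
         - - 1#                ≈⟨ -‿cong v^2j≈-1 ⟨
         - (v ^ (j ℕ.* 2))     ≈⟨ -‿cong (trans (^-congˡ (j ℕ.* 2) v≈0) (0^k≈0 (j ℕ.* 2))) ⟩
         - 0#                  ≈⟨ -0#≈0# ⟩
         0#                    ∎)
    where
    0^k≈0 : ∀ k .{{_ : NonZero k}} → 0# ^ k ≈ 0#
    0^k≈0 (suc k) = zeroˡ (0# ^ k)
    [-1]^[2+2j]≈1 : (- 1#) ^ (2 ℕ.+ j ℕ.* 2) ≈ 1#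
    [-1]^[2+2j]≈1 = begin
      (- 1#) ^ (2 ℕ.+ j ℕ.* 2)     ≈⟨ ^-congʳ (- 1#) (≡.cong (2 ℕ.+_) (ℕ.*-comm j 2)) ⟩
      (- 1#) ^ (2 ℕ.+ 2 ℕ.* j)     ≈⟨ ^-congʳ (- 1#) (≡.sym (ℕ.*-suc 2 j)) ⟩
      (- 1#) ^ (2 ℕ.* suc j)       ≈⟨ ^-assocʳ (- 1#) 2 (suc j) ⟨
      ((- 1#) ^ 2) ^ suc j         ≈⟨ ^-congˡ (suc j) (solve 0 (con -[1+ 0 ] :^ 2 := con (+ 1)) refl) ⟩
      1# ^ suc j                   ≈⟨ 1^k≈1 (suc j) ⟩
      1#                           ∎

  -- A nonzero fixed y has y^(q-1) = 1, and (q² - 1)/2 is the multiple (q - 1) · (q + 1)/2 of q - 1.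
  -- The root lies in the extension and may be fixed or anti-fixed.
  square-root : ∀ {y} → ¬ (y ≈ 0#) → Fixed y → ∃[ x ] x * x ≈ y
  square-root {y} y≉0 σy =
    let x , x^2≈y = kth-root 2 ((j ℕ.* 2) ℕ.* suc j) (1+2j-order 2 ((j ℕ.* 2) ℕ.* suc j) (rearrange j)) (begin
          y ^ ((j ℕ.* 2) ℕ.* suc j)      ≈⟨ ^-assocʳ y (j ℕ.* 2) (suc j) ⟨
          (y ^ (j ℕ.* 2)) ^ suc j        ≈⟨ ^-congˡ (suc j) (Fixed⇒x^2j≈1 y≉0 σy) ⟩
          1# ^ suc j                     ≈⟨ 1^k≈1 (suc j) ⟩
          1#                             ∎)
    in x , trans (*-congˡ (sym (*-identityʳ x))) x^2≈y
    where
    rearrange : ∀ j → 2 ℕ.* ((j ℕ.* 2) ℕ.* suc j) ≡ (j ℕ.* 2) ℕ.* (2 ℕ.+ j ℕ.* 2)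
    rearrange = solve-∀

  -- The norm is z^(q+1), and y^(q-1) = 1 is the condition under which `kth-root` produces a
  -- (q+1)-th root.
  norm-surjective : ∀ {y} → ¬ (y ≈ 0#) → Fixed y → ∃[ z ] z * σ z ≈ y
  norm-surjective {y} y≉0 σy =
    let z , z^[q+1]≈y = kth-root (2 ℕ.+ j ℕ.* 2) (j ℕ.* 2)
                          (1+2j-order (2 ℕ.+ j ℕ.* 2) (j ℕ.* 2) (ℕ.*-comm (2 ℕ.+ j ℕ.* 2) (j ℕ.* 2))) (Fixed⇒x^2j≈1 y≉0 σy)
    in z , trans (*-congˡ (σ≈x*x^2j z)) z^[q+1]≈y

  -- Representing fixed elements by s² + 6b².

  module _ (3≉0 : ¬ (3# ≈ 0#)) where

    private
      6# : Carrier
      6# = 2# * 3#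

      6≉0 : ¬ (6# ≈ 0#)
      6≉0 = *-≉0 2≉0 3≉0

    Represents : Carrier → Set _
    Represents r = ∃[ s ] ∃[ b ] Fixed s × Anti b × ¬ (s ≈ 0#) × s * s + 6# * (b * b) ≈ r

    private
      module _ {κ i} (κi≈1 : κ * i ≈ 1#) (κκ≈-6 : κ * κ ≈ - 6#) where

        1+6ii≈0 : 1# + 6# * (i * i) ≈ 0#
        1+6ii≈0 = begin
          1# + 6# * (i * i)                    ≈⟨ +-cong (sym (trans (*-cong κi≈1 κi≈1) (*-identityˡ 1#)))
                                                          (*-congʳ (sym (trans (-‿cong κκ≈-6) (-‿involutive 6#)))) ⟩
          κ * i * (κ * i) + - (κ * κ) * (i * i)
            ≈⟨ solve 2 (λ k i → k :* i :* (k :* i) :+ (:- (k :* k)) :* (i :* i) := con (+ 0)) refl κ i ⟩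
          0#                                   ∎

        -- As i = 1/κ satisfies 6i² = -1, the representation identities hold modulo
        -- `1# + 6# * (i * i)`. The solver proves them with an explicit multiple of this element,
        -- which is then dropped.
        drop-multiple : ∀ x y → x + y * (1# + 6# * (i * i)) ≈ x
        drop-multiple x y = trans (+-congˡ (trans (*-congˡ 1+6ii≈0) (zeroʳ y))) (+-identityʳ x)

        -- With κ anti-fixed the form splits, so s² + 6b² = s² − (κb)² is
        -- factored as r · 1.
        represents-split : Anti κ → ∀ {r} → Fixed r → ¬ (r + 1# ≈ 0#) → Represents r
        represents-split σκ {r} σr r≉-1 =
          -- Solving s + κb = 1 and s - κb = r gives s = (r + 1)/2 and b = (1 - s)/κ; excluding r =
          -- -1 is what makes s nonzero.
          s , (1# - s) * i , σs , Fixed*Anti (Fixed-+ Fixed-1 (Fixed-neg σs)) (Anti-inverse κi≈1 σκ) ,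
          (λ s≈0 → r≉-1 (trans (sym (half+half (r + 1#))) (trans (+-cong s≈0 s≈0) (+-identityˡ 0#)))) ,
          (begin
            s * s + 6# * ((1# - s) * i * ((1# - s) * i))
              ≈⟨ solve 2 (λ s i → s :* s :+ (con (+ 2) :* con (+ 3)) :* ((con (+ 1) :- s) :* i :* ((con (+ 1) :- s) :* i))
                   := ((s :+ s) :- con (+ 1)) :+ ((con (+ 1) :- s) :* (con (+ 1) :- s)) :* (con (+ 1) :+ (con (+ 2) :* con (+ 3)) :* (i :* i)))
                   refl s i ⟩
            ((s + s) - 1#) + ((1# - s) * (1# - s)) * (1# + 6# * (i * i))
              ≈⟨ drop-multiple _ _ ⟩
            (s + s) - 1#         ≈⟨ +-congʳ (half+half (r + 1#)) ⟩
            (r + 1#) - 1#        ≈⟨ solve 1 (λ r → (r :+ con (+ 1)) :- con (+ 1) := r) refl r ⟩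
            r                    ∎)
          where
          s : Carrier
          s = half (r + 1#)
          σs : Fixed s
          σs = Fixed-half (Fixed-+ σr Fixed-1)

        -- With κ fixed the form s² + 6b² = s² − (κb)² is the norm form.
        module _ (σκ : Fixed κ) {r} (σr : Fixed r) (r≉0 : ¬ (r ≈ 0#)) where

          σi : Fixed i
          σi = Fixed-inverse κi≈1 σκ

          represents-norm-of : ∀ {a b} → Fixed a → Anti b → (a + b) * (a - b) ≈ r → ¬ (a ≈ 0#) → Represents r
          represents-norm-of {a} {b} σa σb norm≈r a≉0 = a , i * b , σa , Fixed*Anti σi σb , a≉0 , (begin
            a * a + 6# * (i * b * (i * b))
              ≈⟨ solve 4 (λ k a b i → a :* a :+ k :* (i :* b :* (i :* b))
                   := ((a :+ b) :* (a :- b)) :+ (b :* b) :* (con (+ 1) :+ k :* (i :* i))) refl 6# a b i ⟩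
            (a + b) * (a - b) + (b * b) * (1# + 6# * (i * i))   ≈⟨ drop-multiple _ _ ⟩
            (a + b) * (a - b)                                   ≈⟨ norm≈r ⟩
            r                                                   ∎)

          -- The anti-fixed b is multiplied by (1 + v)² / (1 − v²), of norm 1.
          represents-norm-of-anti : ∀ {b v w} → Anti b → r ≈ - (b * b) → Anti v → ¬ (v ≈ 0#) →
                                    (1# - v * v) * w ≈ 1# → Represents r
          represents-norm-of-anti {b} {v} {w} σb r≈-bb σv v≉0 [1-vv]w≈1 =
            -- With w = 1/(1 - v²), these are the two parts of (1 + v)² w b: the cross term 2vwb is
            -- fixed, being a product with two anti-fixed factors, and nonzero, while the rest is
            -- anti-fixed.
            represents-norm-of {2# * v * w * b} {(1# + v * v) * w * b}
              (Fixed-resp (solve 3 (λ v w b → (con (+ 2) :* (v :* b)) :* w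
                   := con (+ 2) :* v :* w :* b) refl v w b)
                (Fixed-* (Fixed-* Fixed-2 (Anti*Anti σv σb)) σw))
              (Fixed*Anti (Fixed-* (Fixed-+ Fixed-1 (Anti*Anti σv σv)) σw) σb)
              (begin
                (2# * v * w * b + (1# + v * v) * w * b) * (2# * v * w * b - (1# + v * v) * w * b)
                  ≈⟨ solve 3 (λ v w b →
                       (con (+ 2) :* v :* w :* b :+ (con (+ 1) :+ v :* v) :* w :* b) :* (con (+ 2) :* v :* w :* b :- (con (+ 1) :+ v :* v) :* w :* b)
                      
                            := :- (b :* b) :* ((con (+ 1) :- v :* v) :* w :* ((con (+ 1) :- v :* v) :* w))) refl v w b ⟩
                - (b * b) * ((1# - v * v) * w * ((1# - v * v) * w))
                  ≈⟨ *-congˡ (trans (*-cong [1-vv]w≈1 [1-vv]w≈1) (*-identityˡ 1#)) ⟩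
                - (b * b) * 1#     ≈⟨ *-identityʳ _ ⟩
                - (b * b)          ≈⟨ r≈-bb ⟨
                r                  ∎)
              (*-≉0 (*-≉0 (*-≉0 2≉0 v≉0) (unit≉0 (trans (*-comm w _) [1-vv]w≈1))) b≉0)
            where
            b≉0 : ¬ (b ≈ 0#)
            b≉0 b≈0 = r≉0 (trans r≈-bb (trans (-‿cong (trans (*-congʳ b≈0) (zeroˡ b))) -0#≈0#))
            σw : Fixed w
            σw = Fixed-inverse [1-vv]w≈1 (Fixed-+ Fixed-1 (Fixed-neg (Anti*Anti σv σv)))

          represents-norm : Represents r
          represents-norm =
            let z , zσz≈r = norm-surjective r≉0 σr
                a , b , σa , σb , z≈a+b = decompose z
                v , σv , v≉0 = nonzero-anti
                norm≈r = trans (*-cong (sym z≈a+b) (sym (σ-decomposed σa σb z≈a+b))) zσz≈r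
            in from-decomposition σa σb norm≈r σv v≉0 (a ≟ 0#)
            where
            -- v² = 1 would give v = ±1, which is fixed; an element both fixed and anti-fixed is 0.
            1-vv≉0 : ∀ {v} → Anti v → ¬ (v ≈ 0#) → ¬ (1# - v * v ≈ 0#)
            1-vv≉0 {v} σv v≉0 1-vv≈0 = v≉0 (Fixed∧Anti⇒≈0 σv≈v σv)
              where
              σv≈v : Fixed v
              σv≈v = [ (λ v≈1  → Fixed-resp (sym v≈1) Fixed-1)
                     , (λ v≈-1 → Fixed-resp (sym v≈-1) (Fixed-neg Fixed-1))
                     ]′ (square-roots (trans (sym (x-y≈0⇒x≈y 1-vv≈0)) (sym (*-identityˡ 1#))))
            from-decomposition : ∀ {a b v} → Fixed a → Anti b → (a + b) * (a - b) ≈ r →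
                                 Anti v → ¬ (v ≈ 0#) → Dec (a ≈ 0#) → Represents r
            from-decomposition σa σb norm≈r σv v≉0 (no a≉0) = represents-norm-of σa σb norm≈r a≉0
            from-decomposition {a} {b} σa σb norm≈r σv v≉0 (yes a≈0) =
              represents-norm-of-anti σb (begin
                r                       ≈⟨ norm≈r ⟨
                (a + b) * (a - b)       ≈⟨ *-cong (+-congʳ a≈0) (+-congʳ a≈0) ⟩
                (0# + b) * (0# - b)
                  ≈⟨ solve 1 (λ b → (con (+ 0) :+ b) :* (con (+ 0) :- b) := :- (b :* b)) refl b ⟩
                - (b * b)               ∎) σv v≉0 (proj₂ (inverse-of (1-vv≉0 σv v≉0)))

    -- Whether κ is fixed or anti-fixed depends on the field, so `r` must avoid the bad value of
    -- either case: 0 for the norm form, -1 for the split form.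
    represents : ∀ {r} → Fixed r → ¬ (r ≈ 0#) → ¬ (r + 1# ≈ 0#) → Represents r
    represents σr r≉0 r≉-1 =
      let κ , κκ≈-6 = square-root (λ -6≈0 → 6≉0 (-x≈0⇒x≈0 -6≈0)) σ-6
          κ≉0 : ¬ (κ ≈ 0#)
          κ≉0 κ≈0 = 6≉0 (-x≈0⇒x≈0 (trans (sym κκ≈-6) (trans (*-congʳ κ≈0) (zeroˡ κ))))
          κi≈1 = proj₂ (inverse-of κ≉0)
      in [ (λ σκ → represents-norm κi≈1 κκ≈-6 σκ σr r≉0)
         , (λ σκ → represents-split κi≈1 κκ≈-6 σκ σr r≉-1)
         ]′ (square-roots (trans (sym (σ-* κ κ)) (Fixed-resp (sym κκ≈-6) σ-6)))
      where
      σ-6 : Fixed (- 6#)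
      σ-6 = Fixed-neg (Fixed-* Fixed-2 Fixed-3)
      -x≈0⇒x≈0 : ∀ {x} → - x ≈ 0# → x ≈ 0#
      -x≈0⇒x≈0 -x≈0 = trans (sym (-‿involutive _)) (trans (-‿cong -x≈0) -0#≈0#)

  -- Collisions away from characteristic 3.

  module _ (3≉0 : ¬ (3# ≈ 0#)) where

    private
      4≉0 : ¬ (4# ≈ 0#)
      4≉0 4≈0 = *-≉0 2≉0 2≉0 (trans (solve 0 (con (+ 2) :* con (+ 2) := con (+ 4)) refl) 4≈0)

    -- The anti-fixed parts d ∓ e of the two colliding points differ by 2d = δ, and
    -- their fixed parts have equal squares, so tr changes by 48 a₀² d e = −1.
    anti-part≉0⇒¬injective : ∀ {γ c δ a₀ a₁} → ¬ (γ ≈ 0#) → γ ≈ c + δ → Anti δ → ¬ (δ ≈ 0#) →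
      Fixed a₀ → Fixed a₁ → a₀ + c ≈ a₁ → a₁ * a₁ ≈ a₀ * a₀ → ¬ (a₀ ≈ 0#) →
      ¬ Injective _≈_ _≈_ (f q γ)
    anti-part≉0⇒¬injective {γ} {c} {δ} {a₀} {a₁} γ≉0 γ≈c+δ σδ δ≉0 σa₀ σa₁ a₀+c≈a₁ a₁²≈a₀² a₀≉0 =
      -- With the shift equal to γ, the collision condition is γ times (1 plus the change of trace),
      -- so a change of -1 suffices.
      collision⇒¬injective {x = a₀ + (e - d)} γ≉0 (begin
        γ + γ * tr (a₀ + (e - d) + γ)
          ≈⟨ +-congˡ (*-congˡ (trans (tr-decomposed σa₁ (Anti-+ σe σd) shifted)
               (*-cong (*-congˡ a₁²≈a₀²) (+-congʳ a₁²≈a₀²)))) ⟩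
        γ + γ * (4# * A * (A + 3# * ((e + d) * (e + d))))
          ≈⟨ solve 4 (λ γ A d e →
               γ :+ γ :* (con (+ 4) :* A :* (A :+ con (+ 3) :* ((e :+ d) :* (e :+ d))))
               := γ :* (con (+ 4) :* A :* (A :+ con (+ 3) :* ((e :- d) :* (e :- d))))
                  :+ γ :* (con (+ 1) :+ con (+ 4) :* con (+ 4) :* con (+ 3) :* A :* d :* e)) refl γ A d e ⟩
        γ * (4# * A * (A + 3# * ((e - d) * (e - d)))) + γ * (1# + 4# * 4# * 3# * A * d * e)
          ≈⟨ trans (+-congˡ (trans (*-congˡ 1+De≈0) (zeroʳ γ))) (+-identityʳ _) ⟩
        γ * (4# * A * (A + 3# * ((e - d) * (e - d))))
          ≈⟨ *-congˡ (tr-decomposed σa₀ (Anti-+ σe (Anti-neg σd)) refl) ⟨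
        γ * tr (a₀ + (e - d)) ∎)
      where
      d A D : Carrier
      d = half δ
      A = a₀ * a₀
      D = 4# * 4# * 3# * A * d
      σd : Anti d
      σd = Anti-half σδ
      d≉0 : ¬ (d ≈ 0#)
      d≉0 d≈0 = δ≉0 (trans (sym (half+half δ)) (trans (+-cong d≈0 d≈0) (+-identityˡ 0#)))
      D≉0 : ¬ (D ≈ 0#)
      D≉0 = *-≉0 (*-≉0 (*-≉0 (*-≉0 4≉0 4≉0) 3≉0) (*-≉0 a₀≉0 a₀≉0)) d≉0
      e : Carrier
      -- The solution of 1 + De = 0, available because d, and with it D, is nonzero. The other
      -- factors of D are fixed, so e is anti-fixed like d.
      e = - proj₁ (inverse-of D≉0)
      1+De≈0 : 1# + D * e ≈ 0#
      1+De≈0 = trans (+-congˡ (trans (sym (-‿distribʳ-* D _)) (-‿cong (proj₂ (inverse-of D≉0))))) (-‿inverseʳ 1#)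
      σe : Anti e
      σe = Anti-neg (Anti-inverse (proj₂ (inverse-of D≉0))
        (Fixed*Anti (Fixed-* (Fixed-* (Fixed-* Fixed-4 Fixed-4) Fixed-3) (Fixed-* σa₀ σa₀)) σd))
      shifted : a₀ + (e - d) + γ ≈ a₁ + (e + d)
      shifted = begin
        a₀ + (e - d) + γ                ≈⟨ +-congˡ (trans γ≈c+δ (+-congˡ (sym (half+half δ)))) ⟩
        a₀ + (e - d) + (c + (d + d))
          ≈⟨ solve 4 (λ a c d e → a :+ (e :- d) :+ (c :+ (d :+ d)) := (a :+ c) :+ (e :+ d)) refl a₀ c d e ⟩
        (a₀ + c) + (e + d)              ≈⟨ +-congʳ a₀+c≈a₁ ⟩
        a₁ + (e + d)                    ∎

    -- Here tr(x + s) − tr x = 2sw (w² + s² + 6b²) for w = 2a + s, with x = a + b.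
    fixed≉0⇒¬injective : ∀ {γ} → Fixed γ → ¬ (γ ≈ 0#) → ¬ Injective _≈_ _≈_ (f q γ)
    fixed≉0⇒¬injective {γ} σγ γ≉0 =
      let w , σw , ww≈1 , r≉0 = choose-sign
          s , b , σs , σb , s≉0 , ss+6bb≈r = represents 3≉0 (σr σw) r≉0 (r+1≉0 ww≈1)
      in collide σw ww≈1 σs σb s≉0 ss+6bb≈r
      where
      2γ≉0 : ¬ (γ + γ ≈ 0#)
      2γ≉0 2γ≈0 = γ≉0 (double-injective (trans 2γ≈0 (sym (+-identityˡ 0#))))
      g : Carrier
      g = proj₁ (inverse-of 2γ≉0)
      2γg≈1 : (γ + γ) * g ≈ 1#
      2γg≈1 = proj₂ (inverse-of 2γ≉0)
      σg : Fixed g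
      σg = Fixed-inverse 2γg≈1 (Fixed-+ σγ σγ)
      -- The value r required of s² + 6b²: for w² = 1 the collision condition divided by s is 1 +
      -- 2γw(1 + r) = 0, and 1/w = w gives r = -1 - wg with g = 1/(2γ).
      σr : ∀ {w} → Fixed w → Fixed (- 1# - w * g)
      σr σw = Fixed-+ (Fixed-neg Fixed-1) (Fixed-neg (Fixed-* σw σg))

      -- The values of r for w = 1 and w = -1 add up to -2, so they are not both 0.
      choose-sign : ∃[ w ] Fixed w × w * w ≈ 1# × ¬ (- 1# - w * g ≈ 0#)
      choose-sign = from-Dec (- 1# - 1# * g ≟ 0#)
        where
        from-Dec : Dec (- 1# - 1# * g ≈ 0#) → ∃[ w ] Fixed w × w * w ≈ 1# × ¬ (- 1# - w * g ≈ 0#)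
        from-Dec (no r≉0) = 1# , Fixed-1 , *-identityˡ 1# , r≉0
        from-Dec (yes r≈0) = - 1# , Fixed-neg Fixed-1 , solve 0 (con -[1+ 0 ] :* con -[1+ 0 ]
             := con (+ 1)) refl ,
          λ r′≈0 → 2≉0 (begin
          2#
            ≈⟨ solve 1 (λ g → con (+ 2)
                 := :- ((con -[1+ 0 ] :- con (+ 1) :* g) :+ (con -[1+ 0 ] :- con -[1+ 0 ] :* g))) refl g ⟩
          - ((- 1# - 1# * g) + (- 1# - - 1# * g))     ≈⟨ -‿cong (+-cong r≈0 r′≈0) ⟩
          - (0# + 0#)
            ≈⟨ solve 0 (:- (con (+ 0) :+ con (+ 0)) := con (+ 0)) refl ⟩
          0#                                          ∎)

      r+1≉0 : ∀ {w} → w * w ≈ 1# → ¬ (- 1# - w * g + 1# ≈ 0#)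
      r+1≉0 {w} ww≈1 r+1≈0 = *-≉0 (unit≉0 ww≈1) (unit≉0 (trans (*-comm g _) 2γg≈1)) (begin
        w * g
          ≈⟨ solve 1 (λ t → t := :- ((con -[1+ 0 ] :- t) :+ con (+ 1))) refl (w * g) ⟩
        - (- 1# - w * g + 1#)      ≈⟨ -‿cong r+1≈0 ⟩
        - 0#                       ≈⟨ -0#≈0# ⟩
        0#                         ∎)

      collide : ∀ {w s b} → Fixed w → w * w ≈ 1# → Fixed s → Anti b → ¬ (s ≈ 0#) →
                s * s + 2# * 3# * (b * b) ≈ - 1# - w * g → ¬ Injective _≈_ _≈_ (f q γ)
      -- From w = 2a + s, the fixed parts of the two points are (w - s)/2 and (w + s)/2. The solver
      -- sees the halves `W` and `S` as atoms; their doubles are folded back into `w` and `s`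
      -- afterwards.
      collide {w} {s} {b} σw ww≈1 σs σb s≉0 ss+6bb≈r = collision⇒¬injective {x = (W - S) + b} s≉0 (begin
        s + γ * tr ((W - S) + b + s)
          ≈⟨ +-cong (sym (half+half s)) (*-congˡ (tr-decomposed (Fixed-+ σW σS) σb shifted)) ⟩
        (S + S) + γ * (4# * ((W + S) * (W + S)) * ((W + S) * (W + S) + 3# * (b * b)))
          ≈⟨ +-congˡ (*-congˡ (solve 3 (λ W S B →
               con (+ 4) :* ((W :+ S) :* (W :+ S)) :* ((W :+ S) :* (W :+ S) :+ con (+ 3) :* B)
               := con (+ 4) :* ((W :- S) :* (W :- S)) :* ((W :- S) :* (W :- S) :+ con (+ 3) :* B)
                  :+ con (+ 2) :* (S :+ S) :* (W :+ W) :* ((W :+ W) :* (W :+ W) :+ ((S :+ S) :* (S :+ S) :+ con (+ 2) :* con (+ 3) :* B)))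
               refl W S (b * b))) ⟩
        (S + S) + γ * (T + 2# * (S + S) * (W + W) * ((W + W) * (W + W) + ((S + S) * (S + S) + 2# * 3# * (b * b))))
          ≈⟨ +-cong (half+half s) (*-congˡ (+-congˡ (*-cong (*-cong (*-congˡ (half+half s)) (half+half w))
               (+-cong (trans (*-cong (half+half w) (half+half w)) ww≈1)
                 (trans (+-congʳ (*-cong (half+half s) (half+half s))) ss+6bb≈r))))) ⟩
        s + γ * (T + 2# * s * w * (1# + (- 1# - w * g)))
          ≈⟨ solve 5 (λ s γ T w g → s :+ γ :* (T :+ con (+ 2) :* s :* w :* (con (+ 1) :+ (con -[1+ 0 ] :- w :* g)))
               := γ :* T :+ s :* (con (+ 1) :- w :* w :* ((γ :+ γ) :* g))) refl s γ T w g ⟩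
        γ * T + s * (1# - w * w * ((γ + γ) * g))
          ≈⟨ +-congˡ (*-congˡ (x≈y⇒x-y≈0 (sym (trans (*-cong ww≈1 2γg≈1) (*-identityˡ 1#))))) ⟩
        γ * T + s * 0#      ≈⟨ trans (+-congˡ (zeroʳ s)) (+-identityʳ _) ⟩
        γ * T               ≈⟨ *-congˡ (tr-decomposed (Fixed-+ σW (Fixed-neg σS)) σb refl) ⟨
        γ * tr ((W - S) + b)  ∎)
        where
        W S T : Carrier
        W = half w
        S = half s
        T = 4# * ((W - S) * (W - S)) * ((W - S) * (W - S) + 3# * (b * b))
        σW : Fixed W
        σW = Fixed-half σw
        σS : Fixed S
        σS = Fixed-half σs
        shifted : (W - S) + b + s ≈ (W + S) + b
        shifted = trans (+-congˡ (sym (half+half s)))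
          (solve 3 (λ W S b → (W :- S) :+ b :+ (S :+ S) := (W :+ S) :+ b) refl W S b)

    permutation⇒γ≈0 : ∀ {γ} → IsPermutationPolynomial (f q γ) → γ ≈ 0#
    permutation⇒γ≈0 {γ} (inj , _) = let c , δ , σc , σδ , γ≈c+δ = decompose γ in go σc σδ γ≈c+δ (δ ≟ 0#) (c ≟ 0#) (γ ≟ 0#)
      where
      go : ∀ {c δ} → Fixed c → Anti δ → γ ≈ c + δ → Dec (δ ≈ 0#) → Dec (c ≈ 0#) → Dec (γ ≈ 0#) → γ ≈ 0#
      go σc σδ γ≈c+δ _ _ (yes γ≈0) = γ≈0
      go {c} σc σδ γ≈c+δ (yes δ≈0) _ (no γ≉0) = ⊥-elim (fixed≉0⇒¬injective
        (Fixed-resp (sym (trans γ≈c+δ (trans (+-congˡ δ≈0) (+-identityʳ c)))) σc) γ≉0 inj)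
      -- The requirement is (a₀ + c)² = a₀² with a₀ ≠ 0. For c = 0 any nonzero fixed a₀ works, here
      -- 1; otherwise a₀ = -c/2 is forced.
      go σc σδ γ≈c+δ (no δ≉0) (yes c≈0) (no γ≉0) = ⊥-elim (anti-part≉0⇒¬injective γ≉0 γ≈c+δ σδ δ≉0
        Fixed-1 Fixed-1 (trans (+-congˡ c≈0) (+-identityʳ 1#)) refl 1≉0 inj)
      go {c} σc σδ γ≈c+δ (no δ≉0) (no c≉0) (no γ≉0) = ⊥-elim (anti-part≉0⇒¬injective γ≉0 γ≈c+δ σδ δ≉0
          (Fixed-neg (Fixed-half σc)) (Fixed-half σc)
          (trans (+-congˡ (sym (half+half c))) (solve 1 (λ h → :- h :+ (h :+ h) := h) refl (half c)))
          (solve 1 (λ h → h :* h := (:- h) :* (:- h)) refl (half c))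
          (λ -h≈0 → c≉0 (begin
            c                            ≈⟨ half+half c ⟨
            half c + half c              ≈⟨ solve 1 (λ h → h :+ h := :- (:- h :+ :- h)) refl (half c) ⟩
            - (- half c + - half c)      ≈⟨ -‿cong (+-cong -h≈0 -h≈0) ⟩
            - (0# + 0#)                  ≈⟨ solve 0 (:- (con (+ 0) :+ con (+ 0)) := con (+ 0)) refl ⟩
            0#                           ∎)) inj)

  γ≈0⇒permutation : ∀ {γ} → γ ≈ 0# → IsPermutationPolynomial (f q γ)
  γ≈0⇒permutation {γ} γ≈0 =
    (λ {x} {y} fx≈fy → trans (sym (f≈id x)) (trans fx≈fy (f≈id y))) ,
    λ y → y , λ {x} x≈y → trans (f≈id x) x≈y
    where
    f≈id : ∀ x → f q γ x ≈ x
    f≈id x = trans (+-congˡ (trans (*-congʳ γ≈0) (zeroˡ _))) (+-identityʳ x)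

  -- Characteristic 3.

  module _ (3≈0 : 3# ≈ 0#) where

    -- With y = σ x the expanded trace factors as (x + y)(x³ + y³), and cubing is additive here. The
    -- solver step records the discrepancy -3xy(x + y)² explicitly.
    tr≈[x+σx]^4 : ∀ x → tr x ≈ (x + σ x) ^ 4
    tr≈[x+σx]^4 x = begin
      tr x                                                ≈⟨ tr-expand x ⟩
      (x ^ 4 + σ x * x ^ 3) + (σ x ^ 4 + x * σ x ^ 3)
        ≈⟨ solve 2 (λ x y → ((x :^ 4) :+ y :* (x :^ 3)) :+ ((y :^ 4) :+ x :* (y :^ 3))
             := ((x :+ y) :^ 4) :+ con (+ 3) :* (:- (x :* y :* ((x :+ y) :^ 2)))) refl x (σ x) ⟩
      (x + σ x) ^ 4 + 3# * (- (x * σ x * (x + σ x) ^ 2))  ≈⟨ +-congˡ (trans (*-congʳ 3≈0) (zeroˡ _)) ⟩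
      (x + σ x) ^ 4 + 0#                                  ≈⟨ +-identityʳ _ ⟩
      (x + σ x) ^ 4                                       ∎

    trace-cong : ∀ {x y} → x ≈ y → x + σ x ≈ y + σ y
    trace-cong x≈y = +-cong x≈y (σ-cong x≈y)

    trace-translate : ∀ γ x {t} → Fixed t →
      (x + γ * t) + σ (x + γ * t) ≈ (x + σ x) + (γ + σ γ) * t
    trace-translate γ x {t} σt = begin
      (x + γ * t) + σ (x + γ * t)
        ≈⟨ +-congˡ (trans (σ-+ x (γ * t)) (+-congˡ (trans (σ-* γ t) (*-congˡ σt)))) ⟩
      (x + γ * t) + (σ x + σ γ * t)
        ≈⟨ solve 5 (λ x y c d t → (x :+ c :* t) :+ (y :+ d :* t)
             := (x :+ y) :+ (c :+ d) :* t) refl x (σ x) γ (σ γ) t ⟩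
      (x + σ x) + (γ + σ γ) * t        ∎

    Fixed-^ : ∀ {x} m → Fixed x → Fixed (x ^ m)
    Fixed-^ m σx = trans (σ-^ _ m) (^-congˡ m σx)

    -- Adding γt with t fixed leaves x + σ x unchanged. Hence `f` preserves each fibre of x ↦ x + σ
    -- x and acts on it as a translation, which is undone by subtracting the same term.
    anti⇒permutation : ∀ {γ} → γ + σ γ ≈ 0# → IsPermutationPolynomial (f q γ)
    anti⇒permutation {γ} γ+σγ≈0 = injective , surjective
      where
      trace-invariant : ∀ x {t} → Fixed t → (x + γ * t) + σ (x + γ * t) ≈ x + σ x
      trace-invariant x {t} σt = trans (trace-translate γ x σt)
        (trans (+-congˡ (trans (*-congʳ γ+σγ≈0) (zeroˡ t))) (+-identityʳ _))
      trace-f : ∀ x → f q γ x + σ (f q γ x) ≈ x + σ x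
      trace-f x = trace-invariant x (Fixed-trace (x ^ 4 + x ^ (q ℕ.+ 3)))
      f≈ : ∀ x → f q γ x ≈ x + γ * (x + σ x) ^ 4
      f≈ x = +-congˡ (*-congˡ (tr≈[x+σx]^4 x))
      injective : Injective _≈_ _≈_ (f q γ)
      injective {x} {y} fx≈fy = begin
        x
          ≈⟨ solve 2 (λ x t → x := (x :+ t) :- t) refl x (γ * (x + σ x) ^ 4) ⟩
        x + γ * (x + σ x) ^ 4 - γ * (x + σ x) ^ 4
          ≈⟨ +-cong (trans (sym (f≈ x)) (trans fx≈fy (f≈ y))) (-‿cong (*-congˡ (^-congˡ 4
               (trans (sym (trace-f x)) (trans (trace-cong fx≈fy) (trace-f y)))))) ⟩
        y + γ * (y + σ y) ^ 4 - γ * (y + σ y) ^ 4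
          ≈⟨ solve 2 (λ x t → x := (x :+ t) :- t) refl y (γ * (y + σ y) ^ 4) ⟨
        y                                    ∎
      surjective : ∀ y → ∃[ x ] (∀ {z} → z ≈ x → f q γ z ≈ y)
      surjective y = x , λ {z} z≈x → begin
        f q γ z                                ≈⟨ f-cong γ z≈x ⟩
        f q γ x                                ≈⟨ f≈ x ⟩
        x + γ * (x + σ x) ^ 4
          ≈⟨ +-congˡ (*-congˡ (^-congˡ 4 (trace-invariant y (Fixed-neg (Fixed-^ 4 (Fixed-trace y)))))) ⟩
        y + γ * - t + γ * t
          ≈⟨ solve 3 (λ y g t → y :+ g :* (:- t) :+ g :* t := y) refl y γ t ⟩
        y                                      ∎
        where
        t x : Carrier
        t = (y + σ y) ^ 4
        x = y + γ * - t

    -- If d = γ + σ γ were nonzero, the fixed τ with τ³ = −1/d would make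
    -- −γ τ⁴, of trace τ, a second zero of f.
    permutation⇒anti : 3 ∣ q → ∀ {γ} → IsPermutationPolynomial (f q γ) → γ + σ γ ≈ 0#
    permutation⇒anti (divides m q≡m*3) {γ} (inj , _) with γ + σ γ ≟ 0#
    ... | yes eq = eq
    ... | no d≉0 = contradiction y≈0 (unit≉0 (trans (*-comm y d) dy≈1))
      where
      d y τ x : Carrier
      d = γ + σ γ
      y = proj₁ (inverse-of d≉0)
      dy≈1 : d * y ≈ 1#
      dy≈1 = proj₂ (inverse-of d≉0)
      σ-y : Fixed (- y)
      σ-y = Fixed-neg (Fixed-inverse dy≈1 (Fixed-trace γ))
      -- Since q = 3m, the m-th power inverts cubing on fixed elements: τ³ is `σ (- y)`, which
      -- equals -y.
      τ = (- y) ^ m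
      στ : Fixed τ
      στ = Fixed-^ m σ-y
      τ³≈-y : τ ^ 3 ≈ - y
      τ³≈-y = begin
        ((- y) ^ m) ^ 3       ≈⟨ ^-assocʳ (- y) m 3 ⟩
        (- y) ^ (m ℕ.* 3)     ≈⟨ ^-congʳ (- y) (≡.sym q≡m*3) ⟩
        σ (- y)               ≈⟨ σ-y ⟩
        - y                   ∎
      trace-0 : 0# + σ 0# ≈ 0#
      trace-0 = trans (+-congˡ σ-0) (+-identityˡ 0#)
      f-0 : f q γ 0# ≈ 0#
      f-0 = begin
        0# + γ * tr 0#              ≈⟨ +-congˡ (*-congˡ (trans (tr≈[x+σx]^4 0#) (^-congˡ 4 trace-0))) ⟩
        0# + γ * 0# ^ 4
          ≈⟨ solve 1 (λ g → con (+ 0) :+ g :* (con (+ 0) :^ 4) := con (+ 0)) refl γ ⟩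
        0#                          ∎
      x = 0# + γ * - (τ ^ 4)
      trace-x : x + σ x ≈ τ
      trace-x = begin
        x + σ x                          ≈⟨ trace-translate γ 0# (Fixed-neg (Fixed-^ 4 στ)) ⟩
        (0# + σ 0#) + d * - (τ ^ 4)
          ≈⟨ +-cong trace-0 (solve 2 (λ c t → c :* (:- (t :^ 4)) := t :* (c :* (:- (t :^ 3)))) refl d τ) ⟩
        0# + τ * (d * - (τ ^ 3))
          ≈⟨ trans (+-identityˡ _) (*-congˡ (*-congˡ (trans (-‿cong τ³≈-y) (-‿involutive y)))) ⟩
        τ * (d * y)                      ≈⟨ trans (*-congˡ dy≈1) (*-identityʳ τ) ⟩
        τ                                ∎
      f-x : f q γ x ≈ 0#
      f-x = begin
        x + γ * tr x
          ≈⟨ +-congˡ (*-congˡ (trans (tr≈[x+σx]^4 x) (^-congˡ 4 trace-x))) ⟩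
        0# + γ * - (τ ^ 4) + γ * τ ^ 4
          ≈⟨ solve 2 (λ g t → con (+ 0) :+ g :* (:- t) :+ g :* t := con (+ 0)) refl γ (τ ^ 4) ⟩
        0#                                    ∎
      τ≈0 : τ ≈ 0#
      τ≈0 = trans (sym trace-x) (trans (trace-cong (inj (trans f-x (sym f-0)))) trace-0)
      y≈0 : y ≈ 0#
      y≈0 = begin
        y          ≈⟨ -‿involutive y ⟨
        - - y      ≈⟨ -‿cong τ³≈-y ⟨
        - (τ ^ 3)  ≈⟨ -‿cong (trans (*-congʳ τ≈0) (zeroˡ _)) ⟩
        - 0#       ≈⟨ -0#≈0# ⟩
        0#         ∎

  -- Recognising characteristic 3.

  3·1≈3# : 3 · 1# ≈ 3#
  3·1≈3# = solve 0 (con (+ 1) :+ (con (+ 1) :+ (con (+ 1) :+ con (+ 0))) := con (+ 3)) refl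

  -- Used contrapositively, to obtain `3# ≉ 0#` from the hypothesis on the characteristic. As 3 must
  -- generate the whole kernel, the residues 1 and 2 have to be excluded as well.
  3≈0⇒HasCharacteristic-3 : 3# ≈ 0# → HasCharacteristic 3
  3≈0⇒HasCharacteristic-3 3≈0 m = mk⇔ (3∣ m) (λ 3∣m → ∣⇒·≈0 {3} {m} 3·1≈0 3∣m 1#)
    where
    3·1≈0 : 3 · 1# ≈ 0#
    3·1≈0 = trans 3·1≈3# 3≈0
    3∣ : ∀ m → m · 1# ≈ 0# → 3 ∣ m
    3∣ 0 _ = divides 0 ≡.refl
    3∣ 1 1·1≈0 = contradiction (trans (sym (+-identityʳ 1#)) 1·1≈0) 1≉0
    3∣ 2 2·1≈0 = contradiction (trans (+-congˡ (sym (+-identityʳ 1#))) 2·1≈0) 2≉0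
    3∣ (suc (suc (suc m))) eq = ℕ.∣m∣n⇒∣m+n (divides 1 ≡.refl) (3∣ m (begin
      m · 1#
        ≈⟨ solve 1 (λ x → x := (con (+ 1) :+ (con (+ 1) :+ (con (+ 1) :+ x))) :- con (+ 3)) refl (m · 1#) ⟩
      suc (suc (suc m)) · 1# - 3#    ≈⟨ +-cong eq (-‿cong 3≈0) ⟩
      0# - 0#                        ≈⟨ -‿inverseʳ 0# ⟩
      0#                             ∎))

  -- The base field as the set of fixed elements.

  module _ {c′ ℓ₁′ ℓ₂′} (k : HeytingField c′ ℓ₁′ ℓ₂′) (k-order : FieldNotions.HasOrder k q)
           (extension : FieldExtension k K) where
    open FieldExtension extension
    open IsRingMonomorphism isRingMonomorphism
    private
      module k = FiniteField k k-order
      module k-order = Inverse k-order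

    embed-^ : ∀ a m → embed (a k.^ m) ≈ embed a ^ m
    embed-^ a zero    = 1#-homo
    embed-^ a (suc m) = trans (*-homo a (a k.^ m)) (*-congˡ (embed-^ a m))

    InBaseField⇒Fixed : ∀ {x} → InBaseField x → Fixed x
    InBaseField⇒Fixed (a , embed-a≈x) = Fixed-resp embed-a≈x
      (trans (sym (embed-^ a q)) (⟦⟧-cong (k.x^order≈x a)))

    x^q-x-Polynomial : Polynomial q 1# (λ x → x ^ q + - 1# * x ^ 1)
    x^q-x-Polynomial = Polynomial-resp q (+-identityʳ 1#) (λ _ → refl)
      (Polynomial-+ q (Polynomial-^ q) (Polynomial-< (ℕ.<⇒<′ (2≤primePower q-primePower))
        (Polynomial-scale 1 (- 1#) (Polynomial-^ 1))))

    -- A fixed element outside the image would be a further root of x^q − x.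
    Fixed⇒InBaseField : ∀ {x} → Fixed x → InBaseField x
    Fixed⇒InBaseField {x} σx
      with k.search {P = λ a → embed a ≈ x} (λ a≈b → trans (⟦⟧-cong (k.sym a≈b))) (λ a → embed a ≟ x)
    ... | yes found = found
    ... | no ¬found = contradiction
      (leading-coefficient≈0 q x^q-x-Polynomial r r-injective (λ i → root (r-fixed i))) 1≉0
      where
      r : Fin (suc q) → Carrier
      r zero    = x
      r (suc i) = embed (k-order.from i)
      r-injective : ∀ {i j} → r i ≈ r j → i ≡ j
      r-injective {zero}  {zero}  _  = ≡.refl
      r-injective {zero}  {suc j} eq = contradiction (k-order.from j , sym eq) ¬found
      r-injective {suc i} {zero}  eq = contradiction (k-order.from i , eq) ¬found
      r-injective {suc i} {suc j} eq = ≡.cong suc (≡.trans (≡.sym (k-order.strictlyInverseˡ i))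
        (≡.trans (k-order.to-cong (injective eq)) (k-order.strictlyInverseˡ j)))
      r-fixed : ∀ i → Fixed (r i)
      r-fixed zero    = σx
      r-fixed (suc i) = InBaseField⇒Fixed (k-order.from i , refl)
      root : ∀ {y} → Fixed y → y ^ q + - 1# * y ^ 1 ≈ 0#
      root {y} σy = trans (+-cong σy (solve 1 (λ y → con -[1+ 0 ] :* (y :^ 1) := :- y) refl y)) (-‿inverseʳ y)

    module _ {u α} (nonresidue : FieldNotions.IsQuadraticNonResidue k u) (α²≈u : α ^ 2 ≈ embed u) where

      -- α² lies in the base field, so σ α = ±α. The plus sign would put α in the base field and
      -- make u a square there.
      Anti-α : Anti α
      Anti-α = [ (λ σα → contradiction (residue (Fixed⇒InBaseField σα)) nonresidue) , (λ σα → σα) ]′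
        (square-roots (begin
          σ α * σ α        ≈⟨ σ-* α α ⟨
          σ (α * α)        ≈⟨ σ-cong αα≈u ⟩
          σ (embed u)      ≈⟨ InBaseField⇒Fixed (u , refl) ⟩
          embed u          ≈⟨ αα≈u ⟨
          α * α            ∎))
        where
        αα≈u : α * α ≈ embed u
        αα≈u = trans (*-congˡ (sym (*-identityʳ α))) α²≈u
        residue : InBaseField α → ∃[ v ] v k.^ 2 k.≈ u
        residue (v , embed-v≈α) = v , injective (trans (embed-^ v 2) (trans (^-congˡ 2 embed-v≈α) α²≈u))

      α≉0 : ¬ (α ≈ 0#)
      α≉0 α≈0 = nonresidue (k.0# , injective (begin
        embed (k.0# k.^ 2)   ≈⟨ embed-^ k.0# 2 ⟩
        embed k.0# ^ 2       ≈⟨ ^-congˡ 2 (trans 0#-homo (sym α≈0)) ⟩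
        α ^ 2                ≈⟨ α²≈u ⟩
        embed u              ∎))

      -- Because α is anti-fixed, αγ - σ(αγ) = α(γ + σ γ), and α is nonzero.
      InBaseField-αγ⇔γ+σγ≈0 : ∀ γ → InBaseField (α * γ) ⇔ γ + σ γ ≈ 0#
      InBaseField-αγ⇔γ+σγ≈0 γ = mk⇔
        (λ αγ∈k → x*y≈0⇒y≈0 α≉0 (begin
          α * (γ + σ γ)
            ≈⟨ solve 3 (λ a x y → a :* (x :+ y) := a :* x :- (:- a) :* y) refl α γ (σ γ) ⟩
          α * γ - (- α * σ γ)       ≈⟨ x≈y⇒x-y≈0 (trans (sym (InBaseField⇒Fixed αγ∈k)) σ[αγ]) ⟩
          0#                        ∎))
        (λ γ+σγ≈0 → Fixed⇒InBaseField (begin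
          σ (α * γ)                 ≈⟨ σ[αγ] ⟩
          - α * σ γ
            ≈⟨ solve 3 (λ a x y → (:- a) :* y := a :* x :- a :* (x :+ y)) refl α γ (σ γ) ⟩
          α * γ - α * (γ + σ γ)     ≈⟨ +-congˡ (trans (-‿cong (trans (*-congˡ γ+σγ≈0) (zeroʳ α))) -0#≈0#) ⟩
          α * γ + 0#                ≈⟨ +-identityʳ _ ⟩
          α * γ                     ∎))
        where
        σ[αγ] : σ (α * γ) ≈ - α * σ γ
        σ[αγ] = trans (σ-* α γ) (*-congʳ Anti-α)

corollary3p2 :
  ∀ {c ℓ₁ ℓ₂ c′ ℓ₁′ ℓ₂′ : Level}
  (q : ℕ) → IsPrimePower q → ¬ (2 ∣ q) →
  (Fq : HeytingField c ℓ₁ ℓ₂) (Fq² : HeytingField c′ ℓ₁′ ℓ₂′)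
  (extension : FieldExtension Fq Fq²) →
  let module k = FieldNotions Fq
      module K = FieldNotions Fq²
      open FieldExtension extension
  in
  k.HasOrder q → K.HasOrder (q ℕ.^ 2) →
  (γ : K.Carrier) →
  (¬ K.HasCharacteristic 3 →
    K.IsPermutationPolynomial (K.f q γ) ⇔ (γ K.≈ K.0#))
  ×
  (K.HasCharacteristic 3 →
    (u : k.Carrier) (α : K.Carrier) →
    k.IsQuadraticNonResidue u → (α K.^ 2) K.≈ embed u →
    K.IsPermutationPolynomial (K.f q γ) ⇔ InBaseField (α K.* γ))
corollary3p2 q q-primePower 2∤q Fq Fq² extension k-order K-order γ =
  (λ char≢3 → mk⇔
    (λ permutes → permutation⇒γ≈0 (λ 3≈0 → char≢3 (3≈0⇒HasCharacteristic-3 3≈0)) permutes)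
    γ≈0⇒permutation) ,
  λ char≡3 u α nonresidue α²≈u →
    let 3≈0 = trans (sym 3·1≈3#) (Equivalence.from (char≡3 3) (divides 1 ≡.refl))
        αγ⇔ = InBaseField-αγ⇔γ+σγ≈0 Fq k-order extension nonresidue α²≈u γ
    in mk⇔
      (λ permutes → Equivalence.from αγ⇔
        -- `q · 1#` vanishes, so characteristic 3 forces 3 to divide q; this is what provides cube
        -- roots of fixed elements.
        (permutation⇒anti 3≈0 (Equivalence.to (char≡3 q) q·1≈0) permutes))
      (λ αγ∈k → anti⇒permutation 3≈0 (Equivalence.to αγ⇔ αγ∈k))
  where
  open QuadraticExtension Fq² q-primePower 2∤q K-order
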